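{- $\mathsf{TT}^1_2 <_{\mathrm{W}} \mathsf{V}_0 \equiv_{\mathrm{W}} \mathsf{V}_1 <_{\mathrm{W}} \mathsf{V}_2 \equiv_{\mathrm{W}} \mathsf{V}_3 \equiv_{\mathrm{W}} \mathsf{V}_4$.
   Context: A problem $\mathsf{P}$ is a partial multivalued function from $\omega^\omega$ to $\omega^\omega$; elements of its domain are its instances, and for each instance $x$ the set $\mathsf{P}(x)$ of its solutions is nonempty. All objects are coded as elements of $\omega^\omega$ via standard codings. $\mathsf{P} \leq_{\mathrm{W}} \mathsf{Q}$ means there are Turing functionals $\Phi,\Psi$ such that for every instance $x$ of $\mathsf{P}$, $\Phi(x)$ is an instance of $\mathsf{Q}$, and for every $\mathsf{Q}$-solution $y$ of $\Phi(x)$, $\Psi(x\oplus y)$ is a $\mathsf{P}$-solution of $x$; $\equiv_{\mathrm{W}}$ means reducibility in both directions, and $\mathsf{P}<_{\mathrm{W}}\mathsf{Q}$ means $\mathsf{P}\leq_{\mathrm{W}}\mathsf{Q}$ and $\mathsf{Q}\not\leq_{\mathrm{W}}\mathsf{P}$. $\preceq$ is the prefix order on $2^{<\omega}$; $S\cong 2^{<\omega}$ means $(S,\preceq)$ is order-isomorphic to $(2^{<\omega},\preceq)$; $H$ is monochromatic for $f$ if $f$ is constant on $H$. $\mathsf{TT}^1_2$ is the problem whose instances are all $f:2^{<\omega}\to 2$, with solutions all $H\cong 2^{<\omega}$ monochromatic for $f$. A set $D\subseteq 2^{<\omega}$ is dense above $\sigma$ if every $\rho\succeq\sigma$ has an extension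 $\tau\succeq\rho$ in $D$; dense means dense above the empty string. The problems $\mathsf{V}_0,\dots,\mathsf{V}_4$ all have as instances all $f:2^{<\omega}\to 2$, with solutions: $\mathsf{V}_0$: all pairs $\langle i,\sigma\rangle\in 2\times 2^{<\omega}$ with $\{\tau: f(\tau)=i\}$ dense above $\sigma$. $\mathsf{V}_1$: all $\langle i,\sigma\rangle$ such that either $\{\tau:f(\tau)=0\}$ and $\{\tau:f(\tau)=1\}$ are both dense, or $f(\tau)=i$ for all $\tau\succeq\sigma$. $\mathsf{V}_2$: all $\langle i,\sigma\rangle$ such that if $i=0$ then $\{\tau:f(\tau)=0\}$ is dense, and if $i=1$ then $\{\tau:f(\tau)=1\}$ is dense above $\sigma$. $\mathsf{V}_3$: all $\langle i,\sigma\rangle$ such that if $i=0$ then $\{\tau:f(\tau)=0\}$ is dense, and if $i=1$ then all $\tau\succeq\sigma$ with $f(\tau)=0$ are pairwise $\preceq$-comparable. $\mathsf{V}_4$: all $\langle i,\sigma\rangle$ such that if $i=0$ then $\{\tau:f(\tau)=0\}$ is dense, and if $i=1$ then $f(\tau)=1$ for all $\tau\succeq\sigma$. -}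

module Defs where

open import Data.Nat using (ℕ; zero; suc; _+_; _*_; _≤_; _<_)
open import Data.Fin using (Fin)
open import Data.Vec using (Vec; []; _∷_; lookup)
open import Data.List using (List; []; _∷_; _++_)
open import Data.Bool using (Bool; true; false)
open import Data.Product using (Σ; _×_; _,_; ∃)
open import Data.Sum using (_⊎_)
open import Data.Empty using (⊥)
open import Relation.Nullary using (¬_)
open import Relation.Binary.PropositionalEquality using (_≡_)

Baire : Set
Baire = ℕ → ℕ

_⊕_ : Baire → Baire → Baire
(x ⊕ y) zero = x zero
(x ⊕ y) (suc zero) = y zero
(x ⊕ y) (suc (suc n)) = ((λ k → x (suc k)) ⊕ (λ k → y (suc k))) n

-- Turing functionals: partial recursive functions relative to an oracle
-- (Kleene's schemes with an extra oracle-call primitive).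

data Code : ℕ → Set where
  zer  : ∀ {n} → Code n
  succ : Code 1
  proj : ∀ {n} → Fin n → Code n
  orc  : Code 1
  comp : ∀ {n m} → Code m → Vec (Code n) m → Code n
  prec : ∀ {n} → Code n → Code (suc (suc n)) → Code (suc n)
  mu   : ∀ {n} → Code (suc n) → Code n

mutual
  data Eval (α : Baire) : ∀ {n} → Code n → Vec ℕ n → ℕ → Set where
    e-zer  : ∀ {n} {as : Vec ℕ n} → Eval α zer as 0
    e-succ : ∀ {a} → Eval α succ (a ∷ []) (suc a)
    e-proj : ∀ {n} {i : Fin n} {as} → Eval α (proj i) as (lookup as i)
    e-orc  : ∀ {a} → Eval α orc (a ∷ []) (α a)
    e-comp : ∀ {n m} {f : Code m} {gs : Vec (Code n) m} {as bs v} →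
             EvalAll α gs as bs → Eval α f bs v → Eval α (comp f gs) as v
    e-prec0 : ∀ {n} {g : Code n} {h} {as v} →
             Eval α g as v → Eval α (prec g h) (0 ∷ as) v
    e-precS : ∀ {n} {g : Code n} {h} {as k r v} →
             Eval α (prec g h) (k ∷ as) r → Eval α h (k ∷ r ∷ as) v →
             Eval α (prec g h) (suc k ∷ as) v
    e-mu   : ∀ {n} {f : Code (suc n)} {as v} →
             Eval α f (v ∷ as) 0 →
             (∀ j → j < v → Σ ℕ λ w → Eval α f (j ∷ as) (suc w)) →
             Eval α (mu f) as v

  data EvalAll (α : Baire) {n} : ∀ {m} → Vec (Code n) m → Vec ℕ n → Vec ℕ m → Set where
    []  : ∀ {as} → EvalAll α [] as []
    _∷_ : ∀ {m g} {gs : Vec (Code n) m} {as b bs} →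
          Eval α g as b → EvalAll α gs as bs → EvalAll α (g ∷ gs) as (b ∷ bs)

_⟦_⟧↓_ : Code 1 → Baire → Baire → Set
Φ ⟦ x ⟧↓ y = ∀ n → Eval x Φ (n ∷ []) (y n)

record Problem : Set₁ where
  field
    Inst : Baire → Set
    Sol  : Baire → Baire → Set
open Problem public

_≤W_ : Problem → Problem → Set
P ≤W Q = Σ (Code 1) λ Φ → Σ (Code 1) λ Ψ →
  ∀ x → Inst P x →
    Σ Baire λ y → (Φ ⟦ x ⟧↓ y) × Inst Q y ×
      (∀ z → Sol Q y z → Σ Baire λ w → (Ψ ⟦ x ⊕ z ⟧↓ w) × Sol P x w)

_≡W_ : Problem → Problem → Set
P ≡W Q = (P ≤W Q) × (Q ≤W P)

_<W_ : Problem → Problem → Set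
P <W Q = (P ≤W Q) × ¬ (Q ≤W P)

Str : Set
Str = List Bool

-- bijective base-2 coding of 2^{<ω} onto ℕ
enc : Str → ℕ
enc [] = 0
enc (false ∷ s) = 1 + 2 * enc s
enc (true ∷ s)  = 2 + 2 * enc s

_⪯_ : Str → Str → Set
σ ⪯ τ = Σ Str λ υ → σ ++ υ ≡ τ

-- an f : 2^{<ω} → 2 is coded by x with x (enc σ) = f σ
col : Baire → Str → ℕ
col x σ = x (enc σ)

IsColoring : Baire → Set
IsColoring x = ∀ n → x n ≤ 1

DenseAbove : Baire → ℕ → Str → Set
DenseAbove x i σ = ∀ ρ → σ ⪯ ρ → Σ Str λ τ → ρ ⪯ τ × col x τ ≡ i

Dense : Baire → ℕ → Set
Dense x i = DenseAbove x i []

_∈H_ : Str → Baire → Set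
σ ∈H z = z (enc σ) ≡ 1

TT12 : Problem
Inst TT12 x = IsColoring x
Sol TT12 x z =
  (∀ n → z n ≤ 1) ×
  (Σ (Str → Str) λ h →
     (∀ σ → h σ ∈H z) ×
     (∀ τ → τ ∈H z → Σ Str λ σ → h σ ≡ τ) ×
     (∀ σ τ → (σ ⪯ τ → h σ ⪯ h τ) × (h σ ⪯ h τ → σ ⪯ τ))) ×
  (Σ ℕ λ c → ∀ τ → τ ∈H z → col x τ ≡ c)

PairSol : (ℕ → Str → Set) → Baire → Set
PairSol R z = Σ ℕ λ i → Σ Str λ σ → i ≤ 1 × z 0 ≡ i × z 1 ≡ enc σ × R i σ

V0 : Problem
Inst V0 x = IsColoring x
Sol V0 x = PairSol λ i σ → DenseAbove x i σ

V1 : Problem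
Inst V1 x = IsColoring x
Sol V1 x = PairSol λ i σ →
  (Dense x 0 × Dense x 1) ⊎ (∀ τ → σ ⪯ τ → col x τ ≡ i)

V2 : Problem
Inst V2 x = IsColoring x
Sol V2 x = PairSol λ i σ →
  (i ≡ 0 → Dense x 0) × (i ≡ 1 → DenseAbove x 1 σ)

V3 : Problem
Inst V3 x = IsColoring x
Sol V3 x = PairSol λ i σ →
  (i ≡ 0 → Dense x 0) ×
  (i ≡ 1 → ∀ τ τ' → σ ⪯ τ → σ ⪯ τ' → col x τ ≡ 0 → col x τ' ≡ 0 →
             τ ⪯ τ' ⊎ τ' ⪯ τ)

V4 : Problem
Inst V4 x = IsColoring x
Sol V4 x = PairSol λ i σ →
  (i ≡ 0 → Dense x 0) × (i ≡ 1 → ∀ τ → σ ⪯ τ → col x τ ≡ 1)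

{-# OPTIONS --safe #-}
module Submission where

-- V0 ≤ V1, V0 ≤ V2 and V2 ≤ V3 ≤ V4 hold by inclusion of solution sets. For V1 ≤ V0 and V4 ≤ V2,
-- guess a node above which the coloring f is constant, moving to the next node whenever the guess is
-- refuted, and let a string be recolored by its bits at the stages where the guess changes. Above any
-- node shorter than the last change, some cone then contradicts the claim of a solution at this node,
-- so the length of a solution node reveals the limit guess. If the guess changes forever, f is
-- constant on no cone.
--
-- V2 ≰ V1. The answer for the constant coloring 1 names a node σ, with finite use. Vary f among the
-- colorings that extend this use and vanish on a far cone above σ. If a finite condition forces the
-- image to be constant on some cone, that cone is a solution for f = 1 outside the far cone, where the
-- answer must be "1 is dense above some node", and this answer is spoiled by continuing f with 0.
-- Otherwise a generic f has an image with both colors dense, for which every pair is a solution and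
-- the first answer is wrong.
--
-- V0 ≰ TT12. A finite part of a monochromatic tree of color c, enough for an answer, extends to a
-- solution for every later f unless c is dense above no extension of one of finitely many leaves h τ.
-- For each such leaf, if some later f kills c there, then the other color is dense above the leaf and
-- provides a second answer, which stays right as long as c is dead there. So finitely many answers
-- suffice for all f extending one finite condition, and coloring long strings by a single far bit
-- makes all of them wrong.

open import Defs
open import Data.Bool using (Bool; true; false)
open import Data.Empty using (⊥; ⊥-elim)
open import Data.Fin using (Fin; zero; suc)
open import Data.Fin.Patterns using (0F; 1F; 2F; 3F)
open import Data.List using ([]; _∷_; _++_; length; take; drop; replicate)
open import Data.List.Properties using (++-identityʳ; ++-assoc; length-++; length-replicate; ∷-injective)
open import Data.Nat hiding (parity)
open import Data.Nat.Properties
open import Data.Nat.Tactic.RingSolver using (solve-∀)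
open import Data.Product using (Σ; _×_; _,_; ∃; proj₁; proj₂)
open import Data.Sum using (_⊎_; inj₁; inj₂; [_,_]′)
open import Data.Vec using (Vec; []; _∷_; lookup; tabulate)
open import Data.Vec.Properties using (tabulate∘lookup)
open import Function using (_∘_; id)
open import Level using (0ℓ)
open import Axiom.ExcludedMiddle using (ExcludedMiddle)
open import Relation.Binary.Definitions using (tri<; tri≈; tri>)
open import Relation.Binary.PropositionalEquality hiding ([_])
open import Relation.Nullary using (¬_; Dec; yes; no)

-- Binary strings and their codes

⪯-refl : ∀ {σ} → σ ⪯ σ
⪯-refl {σ} = [] , ++-identityʳ σ

⪯-++ : ∀ σ {υ} → σ ⪯ (σ ++ υ)
⪯-++ σ {υ} = υ , refl

⪯-trans : ∀ {σ τ ρ} → σ ⪯ τ → τ ⪯ ρ → σ ⪯ ρ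
⪯-trans {σ} (υ , refl) (υ' , refl) = υ ++ υ' , sym (++-assoc σ υ υ')

⪯-length : ∀ {σ τ} → σ ⪯ τ → length σ ≤ length τ
⪯-length {σ} (υ , refl) = subst (length σ ≤_) (sym (length-++ σ)) (m≤m+n _ _)

⪯-cons : ∀ {b σ τ} → σ ⪯ τ → (b ∷ σ) ⪯ (b ∷ τ)
⪯-cons (υ , refl) = υ , refl

⪯-uncons : ∀ {b c σ τ} → (b ∷ σ) ⪯ (c ∷ τ) → b ≡ c × σ ⪯ τ
⪯-uncons (υ , refl) = refl , υ , refl

⪯-linear : ∀ σ τ {ρ} → σ ⪯ ρ → τ ⪯ ρ → σ ⪯ τ ⊎ τ ⪯ σ
⪯-linear [] τ _ _ = inj₁ (τ , refl)
⪯-linear (b ∷ σ) [] _ _ = inj₂ (b ∷ σ , refl)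
⪯-linear (b ∷ σ) (c ∷ τ) (υ , refl) q with ⪯-uncons q
... | refl , q' with ⪯-linear σ τ (υ , refl) q'
... | inj₁ p = inj₁ (⪯-cons p)
... | inj₂ p = inj₂ (⪯-cons p)

snoc-⪯-head : ∀ σ {b c τ} → (σ ++ b ∷ []) ⪯ τ → (σ ++ c ∷ []) ⪯ τ → b ≡ c
snoc-⪯-head [] (υ , refl) (υ' , e) = sym (proj₁ (∷-injective e))
snoc-⪯-head (d ∷ σ) (υ , refl) q = snoc-⪯-head σ (υ , refl) (proj₂ (⪯-uncons q))

length-snoc : ∀ (σ : Str) b → length (σ ++ b ∷ []) ≡ suc (length σ)
length-snoc σ b = trans (length-++ σ) (+-comm (length σ) 1)

snoc-⋠ : ∀ σ {b} → ¬ ((σ ++ b ∷ []) ⪯ σ)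
snoc-⋠ σ {b} p = <-irrefl refl (subst (_≤ length σ) (length-snoc σ b) (⪯-length p))

length≤enc : ∀ σ → length σ ≤ enc σ
length≤enc [] = z≤n
length≤enc (false ∷ σ) = s≤s (≤-trans (length≤enc σ) (m≤m+n _ _))
length≤enc (true ∷ σ) = s≤s (≤-trans (length≤enc σ) (≤-trans (m≤m+n _ _) (n≤1+n _)))

enc-injective : ∀ σ τ → enc σ ≡ enc τ → σ ≡ τ
enc-injective [] [] p = refl
enc-injective [] (false ∷ τ) ()
enc-injective [] (true ∷ τ) ()
enc-injective (false ∷ σ) [] ()
enc-injective (true ∷ σ) [] ()
enc-injective (false ∷ σ) (false ∷ τ) p =
  cong (false ∷_) (enc-injective σ τ (*-cancelˡ-≡ _ _ 2 (suc-injective p)))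
enc-injective (false ∷ σ) (true ∷ τ) p = ⊥-elim (even≢odd (enc σ) (enc τ) (suc-injective p))
enc-injective (true ∷ σ) (false ∷ τ) p =
  ⊥-elim (even≢odd (enc τ) (enc σ) (sym (suc-injective p)))
enc-injective (true ∷ σ) (true ∷ τ) p =
  cong (true ∷_) (enc-injective σ τ (*-cancelˡ-≡ _ _ 2 (suc-injective (suc-injective p))))

increment : Str → Str
increment [] = false ∷ []
increment (false ∷ σ) = true ∷ σ
increment (true ∷ σ) = false ∷ increment σ

enc-increment : ∀ σ → enc (increment σ) ≡ suc (enc σ)
enc-increment [] = refl
enc-increment (false ∷ σ) = refl
enc-increment (true ∷ σ) rewrite enc-increment σ | +-suc (enc σ) (enc σ + 0) = refl

dec : ℕ → Str
dec zero = []
dec (suc n) = increment (dec n)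

enc-dec : ∀ n → enc (dec n) ≡ n
enc-dec zero = refl
enc-dec (suc n) = trans (enc-increment (dec n)) (cong suc (enc-dec n))

dec-enc : ∀ σ → dec (enc σ) ≡ σ
dec-enc σ = enc-injective _ _ (enc-dec (enc σ))

-- This is 2 to the length. Each leading bit doubles the code of the rest, so it is the factor with
-- which the code of a suffix enters the code of the whole string.
width : Str → ℕ
width [] = 1
width (_ ∷ σ) = width σ + width σ

enc-++ : ∀ σ υ → enc (σ ++ υ) ≡ enc σ + width σ * enc υ
enc-++ [] υ = sym (+-identityʳ _)
enc-++ (false ∷ σ) υ rewrite enc-++ σ υ = lem (enc σ) (width σ) (enc υ)
  where
  lem : ∀ a w b → 1 + 2 * (a + w * b) ≡ (1 + 2 * a) + (w + w) * b
  lem = solve-∀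
enc-++ (true ∷ σ) υ rewrite enc-++ σ υ = lem (enc σ) (width σ) (enc υ)
  where
  lem : ∀ a w b → 2 + 2 * (a + w * b) ≡ (2 + 2 * a) + (w + w) * b
  lem = solve-∀

-- Primitive recursive operations on codes

if0 : {A : Set} → ℕ → A → A → A
if0 zero a b = a
if0 (suc _) a b = b

if0-elim : {A : Set} (Q : A → Set) (n : ℕ) {a b : A} → Q a → Q b → Q (if0 n a b)
if0-elim Q zero p q = p
if0-elim Q (suc _) p q = q

if0-map : {A B : Set} (f : A → B) (n : ℕ) {a b : A} → f (if0 n a b) ≡ if0 n (f a) (f b)
if0-map f zero = refl
if0-map f (suc _) = refl

-- Opaque, since unfolding the nested searches built from this makes conversion checking infeasible.
opaque
  dist : ℕ → ℕ → ℕ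
  dist a b = (a ∸ b) + (b ∸ a)

  dist-refl : ∀ a → dist a a ≡ 0
  dist-refl a rewrite n∸n≡0 a = refl

  dist≡0⇒≡ : ∀ a b → dist a b ≡ 0 → a ≡ b
  dist≡0⇒≡ a b p = ≤-antisym (m∸n≡0⇒m≤n (m+n≡0⇒m≡0 (a ∸ b) p)) (m∸n≡0⇒m≤n (m+n≡0⇒n≡0 (a ∸ b) p))

-- As for mu, the value 0 encodes success.
search : (ℕ → ℕ) → ℕ → ℕ
search f zero = 1
search f (suc n) = if0 (f n) 0 (search f n)

search-sound : ∀ f n → search f n ≡ 0 → Σ ℕ λ e → e < n × f e ≡ 0
search-sound f (suc n) p with f n in eq
... | zero = n , ≤-refl , eq
... | suc _ with search-sound f n p
...   | e , e<n , q = e , m<n⇒m<1+n e<n , q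

search-complete : ∀ f n {e} → e < n → f e ≡ 0 → search f n ≡ 0
search-complete f (suc n) {e} e<1+n p with f n in eq
... | zero = refl
... | suc _ with m≤n⇒m<n∨m≡n (≤-pred e<1+n)
...   | inj₁ e<n = search-complete f n e<n p
...   | inj₂ refl with () ← trans (sym p) eq

natrec : ℕ → (ℕ → ℕ → ℕ) → ℕ → ℕ
natrec z s zero = z
natrec z s (suc k) = s k (natrec z s k)

Least : (ℕ → ℕ) → Set
Least f = Σ ℕ λ e → f e ≡ 0 × (∀ j → j < e → Σ ℕ λ w → f j ≡ suc w)

least : (f : ℕ → ℕ) → (Σ ℕ λ e → f e ≡ 0) → Least f
least f (e , p) = go e f p
  where
  positive : ∀ f {w v} → f 0 ≡ suc w → (∀ j → j < v → Σ ℕ λ w → f (suc j) ≡ suc w) →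
    ∀ j → j < suc v → Σ ℕ λ w → f j ≡ suc w
  positive f p below zero _ = _ , p
  positive f p below (suc j) (s≤s j<v) = below j j<v
  go : ∀ e f → f e ≡ 0 → Least f
  go zero f p = 0 , p , λ _ ()
  go (suc e) f p with f 0 in eq
  ... | zero = 0 , eq , λ _ ()
  ... | suc w with go e (f ∘ suc) p
  ...   | v , q , below = suc v , q , positive f eq below

-- The rounded-down halves of `k` and of `suc k` add up to `k`; hence the recursion by subtraction.
half : ℕ → ℕ
half = natrec 0 λ k r → k ∸ r

half-even : ∀ m → half (2 * m) ≡ m
half-odd : ∀ m → half (1 + 2 * m) ≡ m
half-even zero = refl
half-even (suc m) rewrite +-suc m (m + 0) | half-odd m | +-identityʳ m = m+n∸n≡m (suc m) m
half-odd m rewrite half-even m | +-identityʳ m = m+n∸n≡m m m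

parity : ℕ → ℕ
parity = natrec 0 λ _ r → 1 ∸ r

parity-double : ∀ m → parity (2 * m) ≡ 0
parity-double zero = refl
parity-double (suc m) rewrite +-suc m (m + 0) | parity-double m = refl

tail : ℕ → ℕ
tail n = half (n ∸ 1)

bit : Bool → ℕ
bit false = 0
bit true = 1

-- Codes of nonempty strings are odd when the first bit is `false` and even when it is `true`.
headBit : ℕ → ℕ
headBit n = 1 ∸ parity n

tail-enc : ∀ b σ → tail (enc (b ∷ σ)) ≡ enc σ
tail-enc false σ = half-even (enc σ)
tail-enc true σ = half-odd (enc σ)

headBit-enc : ∀ b σ → headBit (enc (b ∷ σ)) ≡ bit b
headBit-enc false σ rewrite parity-double (enc σ) = refl
headBit-enc true σ rewrite parity-double (enc σ) = refl

tails : ℕ → ℕ → ℕ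
tails n = natrec n λ _ r → tail r

tails-enc : ∀ σ k → tails (enc σ) k ≡ enc (drop k σ)
tails-enc σ zero = refl
tails-enc σ (suc k) = trans (cong tail (tails-enc σ k)) (tail-drop k σ)
  where
  tail-drop : ∀ k (σ : Str) → tail (enc (drop k σ)) ≡ enc (drop (suc k) σ)
  tail-drop zero [] = refl
  tail-drop (suc k) [] = refl
  tail-drop zero (b ∷ σ) = tail-enc b σ
  tail-drop (suc k) (b ∷ σ) = tail-drop k σ

-- position, bit and accumulator
Step : Set
Step = ℕ → ℕ → ℕ → ℕ

-- A code is at least the length of its string, so `n` rounds reach every bit. Once the remaining
-- tail is empty, its code is 0 and the accumulator is left alone.
foldCode : Step → ℕ → ℕ → ℕ
foldCode f a n = natrec a (λ s r → if0 (tails n s) r (f s (headBit (tails n s)) r)) n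

foldStr : Step → ℕ → ℕ → Str → ℕ
foldStr f s a [] = a
foldStr f s a (b ∷ σ) = foldStr f (suc s) (f s (bit b) a) σ

foldStr-++ : ∀ f s a σ υ →
  foldStr f s a (σ ++ υ) ≡ foldStr f (s + length σ) (foldStr f s a σ) υ
foldStr-++ f s a [] υ = cong (λ t → foldStr f t a υ) (sym (+-identityʳ s))
foldStr-++ f s a (b ∷ σ) υ rewrite +-suc s (length σ) = foldStr-++ f (suc s) (f s (bit b) a) σ υ

foldCode-enc : ∀ f a σ → foldCode f a (enc σ) ≡ foldStr f 0 a σ
foldCode-enc f a σ = trans (go (enc σ)) (cong (foldStr f 0 a) (take-all (enc σ) σ (length≤enc σ)))
  where
  take-all : ∀ k (σ : Str) → length σ ≤ k → take k σ ≡ σ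
  take-all zero [] _ = refl
  take-all (suc k) [] _ = refl
  take-all (suc k) (b ∷ σ) (s≤s p) = cong (b ∷_) (take-all k σ p)

  -- The loop after `k` rounds is the fold over the first `k` bits; one more round changes nothing
  -- if the string has at most `k` bits.
  next : ∀ k (σ : Str) s a → foldStr f s a (take (suc k) σ) ≡
    if0 (enc (drop k σ)) (foldStr f s a (take k σ))
        (f (s + k) (headBit (enc (drop k σ))) (foldStr f s a (take k σ)))
  next zero [] s a = refl
  next (suc k) [] s a = refl
  next zero (false ∷ σ) s a rewrite headBit-enc false σ | +-identityʳ s = refl
  next zero (true ∷ σ) s a rewrite headBit-enc true σ | +-identityʳ s = refl
  next (suc k) (b ∷ σ) s a rewrite +-suc s k = next k σ (suc s) (f s (bit b) a)

  go : ∀ k → natrec a (λ s r → if0 (tails (enc σ) s) r (f s (headBit (tails (enc σ) s)) r)) k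
             ≡ foldStr f 0 a (take k σ)
  go zero = refl
  go (suc k) rewrite go k | tails-enc σ k = sym (next k σ 0 a)

widthCode : ℕ → ℕ
widthCode = foldCode (λ _ _ r → r + r) 1

widthCode-enc : ∀ σ → widthCode (enc σ) ≡ width σ
widthCode-enc σ = trans (foldCode-enc _ 1 σ) (trans (go 0 1 σ) (+-identityʳ _))
  where
  go : ∀ s a σ → foldStr (λ _ _ r → r + r) s a σ ≡ a * width σ
  go s a [] = sym (*-identityʳ a)
  go s a (b ∷ σ) = trans (go (suc s) (a + a) σ) (lem a (width σ))
    where
    lem : ∀ a w → (a + a) * w ≡ a * (w + w)
    lem = solve-∀

opaque
  -- the code of dec r ++ dec e
  append : ℕ → ℕ → ℕ
  append r e = r + widthCode r * e

  append-enc : ∀ σ υ → append (enc σ) (enc υ) ≡ enc (σ ++ υ)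
  append-enc σ υ rewrite widthCode-enc σ = sym (enc-++ σ υ)

opaque
  prefixTest : ℕ → ℕ → ℕ
  prefixTest a n = search (λ e → dist (append a e) n) (suc n)

  prefixTest-sound : ∀ σ τ → prefixTest (enc σ) (enc τ) ≡ 0 → σ ⪯ τ
  prefixTest-sound σ τ p with search-sound _ _ p
  ... | e , _ , q = dec e , enc-injective _ _ (trans (sym (append-enc σ (dec e)))
        (trans (cong (append (enc σ)) (enc-dec e)) (dist≡0⇒≡ _ _ q)))

  -- The width is at least 1, so the code of the suffix does not exceed that of the whole string and
  -- the bounded search reaches it.
  prefixTest-complete : ∀ {σ τ} → σ ⪯ τ → prefixTest (enc σ) (enc τ) ≡ 0
  prefixTest-complete {σ} (υ , refl) = search-complete _ _ {enc υ} (s≤s bound)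
    (trans (cong (λ n → dist n (enc (σ ++ υ))) (append-enc σ υ)) (dist-refl (enc (σ ++ υ))))
    where
    width>0 : ∀ σ → 1 ≤ width σ
    width>0 [] = ≤-refl
    width>0 (_ ∷ σ) = ≤-trans (width>0 σ) (m≤m+n _ _)
    bound : enc υ ≤ enc (σ ++ υ)
    bound rewrite enc-++ σ υ = ≤-trans
      (subst (_≤ width σ * enc υ) (*-identityˡ (enc υ)) (*-monoˡ-≤ (enc υ) (width>0 σ))) (m≤n+m _ _)

_⪯?_ : ∀ σ τ → Dec (σ ⪯ τ)
σ ⪯? τ with prefixTest (enc σ) (enc τ) in eq
... | zero = yes (prefixTest-sound σ τ eq)
... | suc _ = no λ p → 1+n≢0 (trans (sym eq) (prefixTest-complete p))

-- Oracle computations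

Agree : ℕ → Baire → Baire → Set
Agree u α β = ∀ n → n < u → α n ≡ β n

agree-trans : ∀ {u α β γ} → Agree u α β → Agree u β γ → Agree u α γ
agree-trans p q n n<u = trans (p n n<u) (q n n<u)

agree-≤ : ∀ {u v α β} → u ≤ v → Agree v α β → Agree u α β
agree-≤ u≤v p n n<u = p n (<-≤-trans n<u u≤v)

mutual
  -- A derivation queries the oracle at finitely many places only, and any oracle with the same
  -- values there admits a derivation of the same result.
  eval-use : ∀ {α n} {c : Code n} {as v} → Eval α c as v →
    Σ ℕ λ u → ∀ β → Agree u α β → Eval β c as v
  eval-use e-zer = 0 , λ _ _ → e-zer
  eval-use e-succ = 0 , λ _ _ → e-succ
  eval-use e-proj = 0 , λ _ _ → e-proj
  eval-use {α} (e-orc {a}) = suc a ,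
    λ β p → subst (Eval β orc (a ∷ [])) (sym (p a ≤-refl)) e-orc
  eval-use (e-comp es e) with evalAll-use es | eval-use e
  ... | u , f | v , g = u ⊔ v , λ β p →
    e-comp (f β (agree-≤ (m≤m⊔n u v) p)) (g β (agree-≤ (m≤n⊔m u v) p))
  eval-use (e-prec0 e) with eval-use e
  ... | u , f = u , λ β p → e-prec0 (f β p)
  eval-use (e-precS e e') with eval-use e | eval-use e'
  ... | u , f | v , g = u ⊔ v , λ β p →
    e-precS (f β (agree-≤ (m≤m⊔n u v) p)) (g β (agree-≤ (m≤n⊔m u v) p))
  eval-use {α} (e-mu {f = c} {as = as} {v = v} e below) with eval-use e | uniform v ≤-refl
    where
    -- The failed tests below `v` are finitely many, so their uses have a common bound.
    uniform : ∀ k → k ≤ v → Σ ℕ λ u → ∀ β → Agree u α β →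
      ∀ j → j < k → Σ ℕ λ w → Eval β c (j ∷ as) (suc w)
    uniform zero _ = 0 , λ _ _ _ ()
    uniform (suc k) k<v with uniform k (<⇒≤ k<v) | below k k<v
    ... | u , f | w , e with eval-use e
    ... | u' , g = u ⊔ u' , λ β p j j<1+k →
      [ f β (agree-≤ (m≤m⊔n u u') p) j
      , (λ { refl → w , g β (agree-≤ (m≤n⊔m u u') p) }) ]′ (m≤n⇒m<n∨m≡n (≤-pred j<1+k))
  ... | u , f | u' , g = u ⊔ u' , λ β p →
    e-mu (f β (agree-≤ (m≤m⊔n u u') p)) (g β (agree-≤ (m≤n⊔m u u') p))

  evalAll-use : ∀ {α n m} {cs : Vec (Code n) m} {as vs} → EvalAll α cs as vs →
    Σ ℕ λ u → ∀ β → Agree u α β → EvalAll β cs as vs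
  evalAll-use [] = 0 , λ _ _ → []
  evalAll-use (e ∷ es) with eval-use e | evalAll-use es
  ... | u , f | v , g = u ⊔ v , λ β p →
    f β (agree-≤ (m≤m⊔n u v) p) ∷ g β (agree-≤ (m≤n⊔m u v) p)

mutual
  eval-deterministic : ∀ {α n} {c : Code n} {as v w} → Eval α c as v → Eval α c as w → v ≡ w
  eval-deterministic e-zer e-zer = refl
  eval-deterministic e-succ e-succ = refl
  eval-deterministic e-proj e-proj = refl
  eval-deterministic e-orc e-orc = refl
  eval-deterministic (e-comp es e) (e-comp es' e') with evalAll-deterministic es es'
  ... | refl = eval-deterministic e e'
  eval-deterministic (e-prec0 e) (e-prec0 e') = eval-deterministic e e'
  eval-deterministic (e-precS e f) (e-precS e' f') with eval-deterministic e e'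
  ... | refl = eval-deterministic f f'
  -- At the smaller of two distinct results of `mu`, the body would evaluate both to 0 and to a
  -- positive number.
  eval-deterministic (e-mu {v = v} e below) (e-mu {v = w} e' below') with <-cmp v w
  ... | tri≈ _ v≡w _ = v≡w
  ... | tri< v<w _ _ with below' v v<w
  ...   | _ , f with () ← eval-deterministic e f
  eval-deterministic (e-mu {v = v} e below) (e-mu {v = w} e' below') | tri> _ _ w<v with below w w<v
  ...   | _ , f with () ← eval-deterministic f e'

  evalAll-deterministic : ∀ {α n m} {cs : Vec (Code n) m} {as vs ws} →
    EvalAll α cs as vs → EvalAll α cs as ws → vs ≡ ws
  evalAll-deterministic [] [] = refl
  evalAll-deterministic (e ∷ es) (e' ∷ es') =
    cong₂ _∷_ (eval-deterministic e e') (evalAll-deterministic es es')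

-- Uniform computability relative to oracles

module _ {I : Set} {o : I → Baire} where

  infixl 6 _+ᶜ_ _∸ᶜ_
  infixl 7 _*ᶜ_

  -- Uniform computability over a family of oracles o i. The index i may carry proofs about the
  -- oracle, which makes unbounded search total.
  record Computable {n} (F : I → Vec ℕ n → ℕ) : Set where
    constructor _by_
    field
      code : Code n
      correct : ∀ i as → Eval (o i) code as (F i as)
  open Computable public

  private variable
    n m : ℕ
    F G H : I → Vec ℕ n → ℕ

  respᶜ : (∀ i as → F i as ≡ G i as) → Computable F → Computable G
  respᶜ p (c by e) = c by λ i as → subst (Eval (o i) c as) (p i as) (e i as)

  varᶜ : (j : Fin n) → Computable λ _ as → lookup as j
  varᶜ j = proj j by λ _ _ → e-proj

  app₁ : {F : I → Vec ℕ 1 → ℕ} → Computable F → Computable G → Computable λ i as → F i (G i as ∷ [])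
  app₁ (c by e) (d by f) = comp c (d ∷ []) by λ i as → e-comp (f i as ∷ []) (e i _)

  app₂ : {F : I → Vec ℕ 2 → ℕ} → Computable F → Computable G → Computable H →
    Computable λ i as → F i (G i as ∷ H i as ∷ [])
  app₂ (c by e) (d by f) (d' by f') =
    comp c (d ∷ d' ∷ []) by λ i as → e-comp (f i as ∷ f' i as ∷ []) (e i _)

  app₃ : {F : I → Vec ℕ 3 → ℕ} {K : I → Vec ℕ n → ℕ} →
    Computable F → Computable G → Computable H → Computable K →
    Computable λ i as → F i (G i as ∷ H i as ∷ K i as ∷ [])
  app₃ (c by e) (d by f) (d' by f') (d'' by f'') =
    comp c (d ∷ d' ∷ d'' ∷ []) by λ i as → e-comp (f i as ∷ f' i as ∷ f'' i as ∷ []) (e i _)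

  eval-vars : ∀ {k α} (ρ : Fin k → Fin n) (as : Vec ℕ n) →
    EvalAll α (tabulate (proj ∘ ρ)) as (tabulate (lookup as ∘ ρ))
  eval-vars {k = zero} ρ as = []
  eval-vars {k = suc k} ρ as = e-proj ∷ eval-vars (ρ ∘ suc) as

  renameᶜ : (ρ : Fin m → Fin n) → Computable F → Computable λ i as → F i (tabulate (lookup as ∘ ρ))
  renameᶜ ρ (c by e) = comp c (tabulate (proj ∘ ρ)) by λ i as → e-comp (eval-vars ρ as) (e i _)

  zeroᶜ : Computable {n} λ _ _ → 0
  zeroᶜ = zer by λ _ _ → e-zer

  sucᶜ : Computable F → Computable λ i as → suc (F i as)
  sucᶜ = app₁ {F = λ { _ (a ∷ []) → suc a }} (succ by λ { _ (_ ∷ []) → e-succ })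

  orcᶜ : Computable F → Computable λ i as → o i (F i as)
  orcᶜ = app₁ {F = λ { i (a ∷ []) → o i a }} (orc by λ { _ (_ ∷ []) → e-orc })

  natrecᶜ : {Z : I → Vec ℕ n → ℕ} {S : I → Vec ℕ (2 + n) → ℕ} →
    Computable Z → Computable S → Computable F →
    Computable λ i as → natrec (Z i as) (λ k r → S i (k ∷ r ∷ as)) (F i as)
  natrecᶜ {F = F} {Z} {S} (z by ez) (s by es) (d by f) =
    comp (prec z s) (d ∷ tabulate proj) by λ i as →
      e-comp (f i as ∷ subst (EvalAll (o i) (tabulate proj) as) (tabulate∘lookup as) (eval-vars id as))
             (loop i as (F i as))
    where
    loop : ∀ i as k → Eval (o i) (prec z s) (k ∷ as) (natrec (Z i as) (λ k r → S i (k ∷ r ∷ as)) k)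
    loop i as zero = e-prec0 (ez i as)
    loop i as (suc k) = e-precS (loop i as k) (es i _)

  μᶜ : {B : I → Vec ℕ (suc n) → ℕ} → Computable B →
    (ex : ∀ i as → Σ ℕ λ e → B i (e ∷ as) ≡ 0) →
    Computable λ i as → proj₁ (least (λ e → B i (e ∷ as)) (ex i as))
  μᶜ {B = B} (c by f) ex = mu c by λ i as →
    let v , p , below = least (λ e → B i (e ∷ as)) (ex i as) in
    e-mu (subst (Eval (o i) c (v ∷ as)) p (f i _))
      λ j j<v → let w , q = below j j<v in w , subst (Eval (o i) c (j ∷ as)) q (f i _)

  if0ᶜ : {K : I → Vec ℕ n → ℕ} → Computable F → Computable G → Computable K →
    Computable λ i as → if0 (F i as) (G i as) (K i as)
  if0ᶜ f g k = app₃
    (respᶜ {G = λ { _ (a ∷ b ∷ c ∷ []) → if0 a b c }}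
      (λ { _ (zero ∷ b ∷ c ∷ []) → refl ; _ (suc a ∷ b ∷ c ∷ []) → refl })
      (natrecᶜ (varᶜ 1F) (varᶜ (suc (suc 2F))) (varᶜ 0F)))
    f g k

  _+ᶜ_ : Computable F → Computable G → Computable λ i as → F i as + G i as
  f +ᶜ g = app₂ (respᶜ {G = λ { _ (a ∷ b ∷ []) → a + b }} (λ { _ (a ∷ b ∷ []) → eq b a })
      (natrecᶜ (varᶜ 1F) (sucᶜ (varᶜ 1F)) (varᶜ 0F))) f g
    where
    eq : ∀ b a → natrec b (λ _ r → suc r) a ≡ a + b
    eq b zero = refl
    eq b (suc a) = cong suc (eq b a)

  _*ᶜ_ : Computable F → Computable G → Computable λ i as → F i as * G i as
  f *ᶜ g = app₂ (respᶜ {G = λ { _ (a ∷ b ∷ []) → a * b }} (λ { _ (a ∷ b ∷ []) → eq b a })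
      (natrecᶜ zeroᶜ (varᶜ 3F +ᶜ varᶜ 1F) (varᶜ 0F))) f g
    where
    eq : ∀ b a → natrec 0 (λ _ r → b + r) a ≡ a * b
    eq b zero = refl
    eq b (suc a) = cong (b +_) (eq b a)

  predᶜ : Computable F → Computable λ i as → pred (F i as)
  predᶜ = app₁ (respᶜ {G = λ { _ (a ∷ []) → pred a }}
    (λ { _ (zero ∷ []) → refl ; _ (suc a ∷ []) → refl }) (natrecᶜ zeroᶜ (varᶜ 0F) (varᶜ 0F)))

  _∸ᶜ_ : Computable F → Computable G → Computable λ i as → F i as ∸ G i as
  f ∸ᶜ g = app₂ (respᶜ {G = λ { _ (a ∷ b ∷ []) → a ∸ b }} (λ { _ (a ∷ b ∷ []) → eq a b })
      (natrecᶜ (varᶜ 0F) (predᶜ (varᶜ 1F)) (varᶜ 1F))) f g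
    where
    eq : ∀ a b → natrec a (λ _ r → pred r) b ≡ a ∸ b
    eq a zero = refl
    eq a (suc b) = trans (cong pred (eq a b)) (pred[m∸n]≡m∸[1+n] a b)

  opaque
    unfolding dist
    distᶜ : Computable F → Computable G → Computable λ i as → dist (F i as) (G i as)
    distᶜ f g = (f ∸ᶜ g) +ᶜ (g ∸ᶜ f)

  oneᶜ : Computable {n} λ _ _ → 1
  oneᶜ = sucᶜ zeroᶜ

  searchᶜ : {B : I → Vec ℕ (suc n) → ℕ} → Computable B → Computable F →
    Computable λ i as → search (λ e → B i (e ∷ as)) (F i as)
  searchᶜ {F = F} {B} b f = respᶜ (λ i as → eq i as (F i as))
      (natrecᶜ oneᶜ (if0ᶜ (renameᶜ skip b) zeroᶜ (varᶜ 1F)) f)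
    where
    skip : ∀ {n} → Fin (suc n) → Fin (2 + n)
    skip zero = zero
    skip (suc j) = suc (suc j)
    eq : ∀ i as k →
      natrec 1 (λ k r → if0 (B i (k ∷ tabulate (lookup as))) 0 r) k
      ≡ search (λ e → B i (e ∷ as)) k
    eq i as zero = refl
    eq i as (suc k) rewrite eq i as k | tabulate∘lookup as = refl

  halfᶜ : Computable F → Computable λ i as → half (F i as)
  halfᶜ f = natrecᶜ zeroᶜ (varᶜ 0F ∸ᶜ varᶜ 1F) f

  tailᶜ : Computable F → Computable λ i as → tail (F i as)
  tailᶜ f = halfᶜ (f ∸ᶜ oneᶜ)

  headBitᶜ : Computable F → Computable λ i as → headBit (F i as)
  headBitᶜ f = oneᶜ ∸ᶜ natrecᶜ zeroᶜ (oneᶜ ∸ᶜ varᶜ 1F) f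

  tailsᶜ : Computable F → Computable G → Computable λ i as → tails (F i as) (G i as)
  tailsᶜ f g = natrecᶜ f (tailᶜ (varᶜ 1F)) g

  foldCodeᶜ : {S : I → Vec ℕ 3 → ℕ} → Computable S → Computable G → Computable F →
    Computable λ i as → foldCode (λ s b r → S i (s ∷ b ∷ r ∷ [])) (G i as) (F i as)
  foldCodeᶜ {S = S} s g f = app₂
    {F = λ i as → foldCode (λ s b r → S i (s ∷ b ∷ r ∷ [])) (lookup as 0F) (lookup as 1F)}
    (natrecᶜ (varᶜ 0F)
      (if0ᶜ (tailsᶜ (varᶜ 3F) (varᶜ 0F)) (varᶜ 1F)
        (app₃ s (varᶜ 0F) (headBitᶜ (tailsᶜ (varᶜ 3F) (varᶜ 0F))) (varᶜ 1F)))
      (varᶜ 1F)) g f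

  widthCodeᶜ : Computable F → Computable λ i as → widthCode (F i as)
  widthCodeᶜ f = foldCodeᶜ {S = λ _ as → lookup as 2F + lookup as 2F} (varᶜ 2F +ᶜ varᶜ 2F) oneᶜ f

  opaque
    unfolding append prefixTest
    appendᶜ : Computable F → Computable G → Computable λ i as → append (F i as) (G i as)
    appendᶜ f g = f +ᶜ widthCodeᶜ f *ᶜ g

    prefixTestᶜ : Computable F → Computable G → Computable λ i as → prefixTest (F i as) (G i as)
    prefixTestᶜ = app₂ {F = λ _ as → prefixTest (lookup as 0F) (lookup as 1F)}
      (searchᶜ (distᶜ (appendᶜ (varᶜ 1F) (varᶜ 0F)) (varᶜ 2F)) (sucᶜ (varᶜ 1F)))

-- Joins of oracles and Weihrauch reductions

⊕-even : ∀ x z n → (x ⊕ z) (n + n) ≡ x n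
⊕-even x z zero = refl
⊕-even x z (suc n) rewrite +-suc n n = ⊕-even (x ∘ suc) (z ∘ suc) n

⊕-odd : ∀ x z n → (x ⊕ z) (suc (n + n)) ≡ z n
⊕-odd x z zero = refl
⊕-odd x z (suc n) rewrite +-suc n n = ⊕-odd (x ∘ suc) (z ∘ suc) n

⊕-agree : ∀ {u x x' z z'} → Agree u x x' → Agree u z z' → Agree u (x ⊕ z) (x' ⊕ z')
⊕-agree p q zero n<u = p 0 n<u
⊕-agree p q (suc zero) n<u = q 0 (<-trans z<s n<u)
⊕-agree {suc u} p q (suc (suc n)) (s≤s n<u) =
  ⊕-agree {u} (λ k k<u → p (suc k) (s≤s k<u)) (λ k k<u → q (suc k) (s≤s k<u)) n (<-trans (n<1+n n) n<u)

≤W-mono : ∀ {P P' Q Q'} →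
  (∀ x → Inst P' x → Inst P x) → (∀ x z → Inst P' x → Sol P x z → Sol P' x z) →
  (∀ y → Inst Q y → Inst Q' y) → (∀ y z → Inst Q y → Sol Q' y z → Sol Q y z) →
  P ≤W Q → P' ≤W Q'
≤W-mono instP solP instQ solQ (Φ , Ψ , red) = Φ , Ψ , λ x px →
  let y , Φx , qy , back = red x (instP x px) in
  y , Φx , instQ y qy , λ z qz →
    let w , Ψxz , s = back z (solQ y z qy qz) in w , Ψxz , solP x w px s

-- An index for the oracles of the backward functional. It includes the proof that `answer` is a
-- solution, so that searches which succeed only for correct answers are total.
record Answered (P Q : Problem) (G : ∃ (Inst P) → Baire) : Set where
  constructor answered
  field
    input : Baire
    input-inst : Inst P input
    answer : Baire
    answer-sol : Sol Q (G (input , input-inst)) answer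
  oracle : Baire
  oracle = input ⊕ answer
open Answered

≤W-intro : ∀ {P Q} {G : ∃ (Inst P) → ℕ → ℕ} {W : Answered P Q G → ℕ → ℕ} →
  Computable {o = proj₁} (λ i as → G i (lookup as 0F)) → (∀ i → Inst Q (G i)) →
  Computable {o = oracle} (λ i as → W i (lookup as 0F)) → (∀ a → Sol P (input a) (W a)) →
  P ≤W Q
≤W-intro (c by e) inst (d by f) sol = c , d , λ x px →
  _ , (λ n → e (x , px) (n ∷ [])) , inst (x , px) , λ z qz →
    _ , (λ n → f (answered x px z qz) (n ∷ [])) , sol (answered x px z qz)

module _ {P Q : Problem} {G : ∃ (Inst P) → Baire} {n} {F : Answered P Q G → Vec ℕ n → ℕ} where
  inputᶜ : Computable {o = oracle} F → Computable {o = oracle} λ a as → input a (F a as)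
  inputᶜ f = respᶜ (λ a as → ⊕-even (input a) (answer a) (F a as)) (orcᶜ (f +ᶜ f))

  answerᶜ : Computable {o = oracle} F → Computable {o = oracle} λ a as → answer a (F a as)
  answerᶜ f = respᶜ (λ a as → ⊕-odd (input a) (answer a) (F a as)) (orcᶜ (sucᶜ (f +ᶜ f)))

≤W-refl : ∀ {P} → P ≤W P
≤W-refl = ≤W-intro {G = proj₁} {W = answer} (orcᶜ (varᶜ 0F)) proj₂ (answerᶜ (varᶜ 0F)) answer-sol

-- Trees in 2^{<ω}

IsEmbedding : (Str → Str) → Set
IsEmbedding h = ∀ σ τ → (σ ⪯ τ → h σ ⪯ h τ) × (h σ ⪯ h τ → σ ⪯ τ)

module Tree (next : Str → Str) (⪯-next : ∀ ρ → ρ ⪯ next ρ) where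

  -- The subtrees start above the two immediate successors of `next ρ`, which keeps incomparable
  -- strings incomparable whatever `next` is.
  tree : Str → Str → Str
  tree ρ [] = next ρ
  tree ρ (b ∷ υ) = tree (next ρ ++ b ∷ []) υ

  -- Every node of the tree is `next` of some extension of `ρ`, and `Q` passes up to that extension.
  tree-property : (Q : Str → Set) → (∀ {ρ τ} → ρ ⪯ τ → Q ρ → Q τ) →
    (R : Str → Set) → (∀ ρ → Q ρ → R (next ρ)) → ∀ ρ υ → Q ρ → R (tree ρ υ)
  tree-property Q up R now ρ [] q = now ρ q
  tree-property Q up R now ρ (b ∷ υ) q =
    tree-property Q up R now _ υ (up (⪯-trans (⪯-next ρ) (⪯-++ (next ρ))) q)

  next-⪯-tree : ∀ ρ υ → next ρ ⪯ tree ρ υ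
  next-⪯-tree ρ [] = ⪯-refl
  next-⪯-tree ρ (b ∷ υ) = ⪯-trans (⪯-++ (next ρ)) (⪯-trans (⪯-next _) (next-⪯-tree _ υ))

  branch-⪯-tree : ∀ ρ b υ → (next ρ ++ b ∷ []) ⪯ tree ρ (b ∷ υ)
  branch-⪯-tree ρ b υ = ⪯-trans (⪯-next _) (next-⪯-tree _ υ)

  tree-embedding : ∀ ρ → IsEmbedding (tree ρ)
  tree-embedding ρ [] τ = (λ _ → next-⪯-tree ρ τ) , λ _ → τ , refl
  tree-embedding ρ (b ∷ σ) [] = (λ ()) ,
    λ p → ⊥-elim (snoc-⋠ (next ρ) (⪯-trans (branch-⪯-tree ρ b σ) p))
  tree-embedding ρ (b ∷ σ) (c ∷ τ) = to , from
    where
    to : (b ∷ σ) ⪯ (c ∷ τ) → tree ρ (b ∷ σ) ⪯ tree ρ (c ∷ τ)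
    to p with ⪯-uncons p
    ... | refl , q = proj₁ (tree-embedding _ σ τ) q
    from : tree ρ (b ∷ σ) ⪯ tree ρ (c ∷ τ) → (b ∷ σ) ⪯ (c ∷ τ)
    from p with snoc-⪯-head (next ρ) (⪯-trans (branch-⪯-tree ρ b σ) p) (branch-⪯-tree ρ c τ)
    ... | refl = ⪯-cons (proj₂ (tree-embedding _ σ τ) p)

  module _ (τ : Str) where

    -- One step of the search for `τ` in the tree: follow the branch that leads towards `τ`, or stay
    -- if neither does. Iterated often enough, it ends at `τ` exactly if `τ` is a node.
    descend : Str → Str
    descend ρ = if0 (prefixTest (enc (next ρ ++ false ∷ [])) (enc τ)) (next ρ ++ false ∷ [])
                (if0 (prefixTest (enc (next ρ ++ true ∷ [])) (enc τ)) (next ρ ++ true ∷ []) ρ)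

    walk : ℕ → Str → Str
    walk zero ρ = ρ
    walk (suc k) ρ = walk k (descend ρ)

    walk-suc : ∀ k ρ → walk (suc k) ρ ≡ descend (walk k ρ)
    walk-suc zero ρ = refl
    walk-suc (suc k) ρ = walk-suc k (descend ρ)

    descend-branch : ∀ ρ b → (next ρ ++ b ∷ []) ⪯ τ → descend ρ ≡ next ρ ++ b ∷ []
    descend-branch ρ false p rewrite prefixTest-complete p = refl
    descend-branch ρ true p with prefixTest (enc (next ρ ++ false ∷ [])) (enc τ) in eq
    ... | suc _ rewrite prefixTest-complete p = refl
    ... | zero with () ← snoc-⪯-head (next ρ) (prefixTest-sound _ τ eq) p

    descend-stop : ∀ ρ → next ρ ≡ τ → descend ρ ≡ ρ
    descend-stop ρ refl with prefixTest (enc (next ρ ++ false ∷ [])) (enc τ) in eq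
    ... | zero = ⊥-elim (snoc-⋠ (next ρ) (prefixTest-sound _ τ eq))
    ... | suc _ with prefixTest (enc (next ρ ++ true ∷ [])) (enc τ) in eq'
    ... | zero = ⊥-elim (snoc-⋠ (next ρ) (prefixTest-sound _ τ eq'))
    ... | suc _ = refl

    walk-stop : ∀ k ρ → next ρ ≡ τ → next (walk k ρ) ≡ τ
    walk-stop zero ρ p = p
    walk-stop (suc k) ρ p rewrite descend-stop ρ p = walk-stop k ρ p

    walk-complete : ∀ k ρ υ → tree ρ υ ≡ τ → length υ ≤ k → next (walk k ρ) ≡ τ
    walk-complete k ρ [] p _ = walk-stop k ρ p
    walk-complete (suc k) ρ (b ∷ υ) p (s≤s l)
      rewrite descend-branch ρ b (subst (_ ⪯_) p (branch-⪯-tree ρ b υ)) =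
      walk-complete k _ υ p l

    walk-sound : ∀ k ρ → next (walk k ρ) ≡ τ → Σ Str λ υ → tree ρ υ ≡ τ
    walk-sound zero ρ p = [] , p
    walk-sound (suc k) ρ p = back (walk-sound k (descend ρ) p)
      where
      Reaches : Str → Set
      Reaches ρ' = (Σ Str λ υ → tree ρ' υ ≡ τ) → Σ Str λ υ → tree ρ υ ≡ τ
      back : Reaches (descend ρ)
      back = if0-elim Reaches (prefixTest (enc (next ρ ++ false ∷ [])) (enc τ)) 
          (λ (υ , q) → false ∷ υ , q)
        (if0-elim Reaches (prefixTest (enc (next ρ ++ true ∷ [])) (enc τ)) 
          (λ (υ , q) → true ∷ υ , q) id)

⪯-antisym-length : ∀ {σ τ} → σ ⪯ τ → length τ ≤ length σ → τ ⪯ σ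
⪯-antisym-length {σ} ([] , refl) _ = subst (_⪯ σ) (sym (++-identityʳ σ)) ⪯-refl
⪯-antisym-length {σ} (b ∷ υ , refl) p =
  ⊥-elim (m+1+n≰m (length σ) (subst (_≤ length σ) (length-++ σ) p))

embedding-cons : ∀ h b → IsEmbedding h → IsEmbedding (h ∘ (b ∷_))
embedding-cons h b emb σ τ =
  (λ p → proj₁ (emb _ _) (⪯-cons p)) , λ p → proj₂ (⪯-uncons (proj₂ (emb _ _) p))

-- Each further bit moves the image to a proper extension, which is longer by at least one.
embedding-length : ∀ h → IsEmbedding h → ∀ σ → length σ ≤ length (h σ)
embedding-length h emb σ = ≤-trans (m≤m+n _ _) (grow σ h emb)
  where
  grow : ∀ σ h → IsEmbedding h → length σ + length (h []) ≤ length (h σ)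
  grow [] h emb = ≤-refl
  grow (b ∷ σ) h emb = ≤-trans
    (subst (_≤ length σ + length (h (b ∷ []))) (+-suc (length σ) _) (+-monoʳ-≤ (length σ) strict))
    (grow σ (h ∘ (b ∷_)) (embedding-cons h b emb))
    where
    strict : length (h []) < length (h (b ∷ []))
    strict = ≰⇒> λ p → snoc-⋠ [] (proj₂ (emb (b ∷ []) [])
      (⪯-antisym-length (proj₁ (emb [] (b ∷ [])) (b ∷ [] , refl)) p))

coloring-cases : ∀ {n} → n ≤ 1 → n ≡ 0 ⊎ n ≡ 1
coloring-cases z≤n = inj₁ refl
coloring-cases (s≤s z≤n) = inj₂ refl

-- The reduction of TT12 to V0

module TT12≤V0 where

  module Solution (x z : Baire) (sol : Sol V0 x z) where
    σ : Str
    σ = proj₁ (proj₂ sol)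

    dense : DenseAbove x (z 0) σ
    dense = let _ , _ , _ , z0≡ , _ , d = sol in subst (λ i → DenseAbove x i σ) (sym z0≡) d

    z1≡ : z 1 ≡ enc σ
    z1≡ = let _ , _ , _ , _ , z1≡ , _ = sol in z1≡

    -- Vacuously 0 when r does not extend σ, so that the search below is total.
    miss : ℕ → ℕ → ℕ
    miss e r = if0 (prefixTest (z 1) r) (dist (x (append r e)) (z 0)) 0

    hit : ∀ r → Σ ℕ λ e → miss e r ≡ 0
    hit r with prefixTest (z 1) r in eq
    ... | suc _ = 0 , refl
    ... | zero with dense (dec r) (prefixTest-sound σ (dec r)
                      (trans (cong₂ prefixTest (sym z1≡) (enc-dec r)) eq))
    ...   | _ , (υ , refl) , p = enc υ , trans (cong (λ n → dist (x n) (z 0)) code≡)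
                                   (trans (cong (λ n → dist n (z 0)) p) (dist-refl (z 0)))
      where
      code≡ : append r (enc υ) ≡ enc (dec r ++ υ)
      code≡ = trans (cong (λ n → append n (enc υ)) (sym (enc-dec r))) (append-enc (dec r) υ)

    jump : ℕ → ℕ
    jump r = proj₁ (least (λ e → miss e r) (hit r))

    nextCode : ℕ → ℕ
    nextCode r = append r (jump r)

    next : Str → Str
    next ρ = ρ ++ dec (jump (enc ρ))

    nextCode-enc : ∀ ρ → nextCode (enc ρ) ≡ enc (next ρ)
    nextCode-enc ρ = trans (cong (append (enc ρ)) (sym (enc-dec (jump (enc ρ))))) (append-enc ρ _)

    next-color : ∀ ρ → σ ⪯ ρ → col x (next ρ) ≡ z 0
    next-color ρ p = dist≡0⇒≡ _ _ (trans (cong (λ n → dist (x n) (z 0)) (sym (nextCode-enc ρ))) found)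
      where
      r = enc ρ
      test : prefixTest (z 1) r ≡ 0
      test = trans (cong (λ n → prefixTest n r) z1≡) (prefixTest-complete p)
      found : dist (x (nextCode r)) (z 0) ≡ 0
      found = trans (cong (λ n → if0 n (dist (x (nextCode r)) (z 0)) 0) (sym test))
                (proj₁ (proj₂ (least (λ e → miss e r) (hit r))))

    open Tree next (λ ρ → ⪯-++ ρ) public

    descendCode : ℕ → ℕ → ℕ
    descendCode t r = if0 (prefixTest (append (nextCode r) 1) t) (append (nextCode r) 1)
      (if0 (prefixTest (append (nextCode r) 2) t) (append (nextCode r) 2) r)

    descendCode-enc : ∀ τ ρ → descendCode (enc τ) (enc ρ) ≡ enc (descend τ ρ)
    descendCode-enc τ ρ = trans
      (cong₂ (λ c d → if0 (prefixTest c (enc τ)) c (if0 (prefixTest d (enc τ)) d (enc ρ)))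
        (branch false) (branch true))
      (sym (trans (if0-map enc (prefixTest (enc (next ρ ++ false ∷ [])) (enc τ)))
        (cong (if0 (prefixTest (enc (next ρ ++ false ∷ [])) (enc τ)) (enc (next ρ ++ false ∷ [])))
          (if0-map enc (prefixTest (enc (next ρ ++ true ∷ [])) (enc τ))))))
      where
      branch : ∀ b → append (nextCode (enc ρ)) (enc (b ∷ [])) ≡ enc (next ρ ++ b ∷ [])
      branch b = trans (cong (λ n → append n (enc (b ∷ []))) (nextCode-enc ρ))
        (append-enc (next ρ) (b ∷ []))

    walkCode : ℕ → ℕ → ℕ
    walkCode t = natrec (z 1) λ _ r → descendCode t r

    walkCode-enc : ∀ τ k → walkCode (enc τ) k ≡ enc (walk τ k σ)
    walkCode-enc τ zero = z1≡
    walkCode-enc τ (suc k) = trans (cong (descendCode (enc τ)) (walkCode-enc τ k))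
      (trans (descendCode-enc τ (walk τ k σ)) (cong enc (sym (walk-suc τ k σ))))

    -- If `t` codes the node `tree σ υ`, then `υ` is no longer than this node, whose length is at
    -- most `t`; so `t` steps of the walk decide membership.
    member : ℕ → ℕ
    member t = if0 (dist (nextCode (walkCode t t)) t) 1 0

    endpoint : ∀ τ → nextCode (walkCode (enc τ) (enc τ)) ≡ enc (next (walk τ (enc τ) σ))
    endpoint τ = trans (cong nextCode (walkCode-enc τ (enc τ))) (nextCode-enc (walk τ (enc τ) σ))

    member-complete : ∀ υ → tree σ υ ∈H member
    member-complete υ = cong (λ n → if0 n 1 0)
      (trans (cong (λ n → dist n (enc τ)) same) (dist-refl (enc τ)))
      where
      τ = tree σ υ
      same : nextCode (walkCode (enc τ) (enc τ)) ≡ enc τ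
      same = trans (endpoint τ) (cong enc (walk-complete τ (enc τ) σ υ refl
        (≤-trans (embedding-length (tree σ) (tree-embedding σ) υ) (length≤enc τ))))

    member-sound : ∀ τ → τ ∈H member → Σ Str λ υ → tree σ υ ≡ τ
    member-sound τ p with dist (nextCode (walkCode (enc τ) (enc τ))) (enc τ) in eq
    ... | zero = walk-sound τ (enc τ) σ
                   (enc-injective _ _ (trans (sym (endpoint τ)) (dist≡0⇒≡ _ _ eq)))

    solution : Sol TT12 x member
    solution =
      (λ t → if0-elim (_≤ 1) (dist (nextCode (walkCode t t)) t) ≤-refl z≤n) ,
      (tree σ , member-complete , member-sound , tree-embedding σ) ,
      z 0 , color
      where
      color : ∀ τ → τ ∈H member → col x τ ≡ z 0
      color τ p with member-sound τ p
      ... | υ , refl = tree-property (σ ⪯_) (λ p q → ⪯-trans q p) (λ τ → col x τ ≡ z 0)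
                         next-color σ υ ⪯-refl

  module S (a : Answered TT12 V0 proj₁) = Solution (input a) (answer a) (answer-sol a)

  private
    A : Set
    A = Answered TT12 V0 proj₁
    variable
      n : ℕ
      F G : A → Vec ℕ n → ℕ

  z0ᶜ : Computable {o = oracle} {n} λ (a : A) _ → answer a 0
  z0ᶜ = answerᶜ zeroᶜ

  z1ᶜ : Computable {o = oracle} {n} λ (a : A) _ → answer a 1
  z1ᶜ = answerᶜ oneᶜ

  nextCodeᶜ : Computable {o = oracle} F → Computable {o = oracle} λ a as → S.nextCode a (F a as)
  nextCodeᶜ f = appendᶜ f (app₁ {F = λ a as → S.jump a (lookup as 0F)}
    (μᶜ (if0ᶜ (prefixTestᶜ z1ᶜ (varᶜ 1F))
              (distᶜ (inputᶜ (appendᶜ (varᶜ 1F) (varᶜ 0F))) z0ᶜ) zeroᶜ)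
        λ a as → S.hit a (lookup as 0F)) f)

  descendCodeᶜ : Computable {o = oracle} F → Computable {o = oracle} G →
    Computable {o = oracle} λ a as → S.descendCode a (F a as) (G a as)
  descendCodeᶜ = app₂ {F = λ a as → S.descendCode a (lookup as 0F) (lookup as 1F)}
    (if0ᶜ (prefixTestᶜ q1 (varᶜ 0F)) q1 (if0ᶜ (prefixTestᶜ q2 (varᶜ 0F)) q2 (varᶜ 1F)))
    where
    q1 = appendᶜ (nextCodeᶜ (varᶜ {n = 2} 1F)) oneᶜ
    q2 = appendᶜ (nextCodeᶜ (varᶜ {n = 2} 1F)) (sucᶜ oneᶜ)

  reduction : TT12 ≤W V0
  reduction = ≤W-intro {G = proj₁} {W = S.member} (orcᶜ (varᶜ 0F)) proj₂
    (if0ᶜ (distᶜ (nextCodeᶜ (natrecᶜ z1ᶜ (descendCodeᶜ (varᶜ 2F) (varᶜ 1F)) (varᶜ 0F))) (varᶜ 0F))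
          oneᶜ zeroᶜ)
    S.solution

bit≤1 : ∀ b → bit b ≤ 1
bit≤1 false = z≤n
bit≤1 true = ≤-refl

foldStr-invariant : ∀ {f} (Q : ℕ → Set) → (∀ s b {r} → Q r → Q (f s (bit b) r)) →
  ∀ s {r} σ → Q r → Q (foldStr f s r σ)
foldStr-invariant Q step s [] q = q
foldStr-invariant Q step s (b ∷ σ) q = foldStr-invariant Q step (suc s) σ (step s b q)

extend-to : ∀ (σ : Str) {M} → length σ ≤ M → Σ Str λ ρ → σ ⪯ ρ × length ρ ≡ M
extend-to σ {M} σ≤M = σ ++ replicate (M ∸ length σ) false , ⪯-++ σ ,
  trans (length-++ σ) (trans (cong (length σ +_) (length-replicate _)) (m+[n∸m]≡n σ≤M))

-- Limit guesses

module Guess (x : Baire) (t : ℕ → ℕ) where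

  mismatch : ℕ → ℕ → ℕ
  mismatch r e = if0 (dist (x (append r e)) (t r)) 1 0

  refuted : ℕ → ℕ → ℕ
  refuted r s = search (mismatch r) s

  -- The guess `r` claims that the color is `t r` on the whole cone above `dec r`. Here `t` is `x`
  -- itself for V1, where any constant cone will do, and constantly 1 for V4.
  guess : ℕ → ℕ
  guess = natrec 0 λ s r → if0 (refuted r s) (suc r) r

  changed : ℕ → ℕ
  changed s = refuted (guess s) s

  Constant : ℕ → Set
  Constant r = ∀ e → x (append r e) ≡ t r

  Quiet : ℕ → Set
  Quiet N = ∀ s → N ≤ s → changed s ≢ 0

  Restless : Set
  Restless = ∀ N → Σ ℕ λ s → N ≤ s × changed s ≡ 0

  guess-changed : ∀ s → changed s ≡ 0 → guess (suc s) ≡ suc (guess s)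
  guess-changed s p rewrite p = refl

  guess-unchanged : ∀ s → changed s ≢ 0 → guess (suc s) ≡ guess s
  guess-unchanged s p with changed s
  ... | zero = ⊥-elim (p refl)
  ... | suc _ = refl

  guess-stable : ∀ {N} → Quiet N → ∀ {s} → N ≤ s → ∀ k → guess (k + s) ≡ guess s
  guess-stable quiet N≤s zero = refl
  guess-stable quiet {s} N≤s (suc k) = trans
    (guess-unchanged (k + s) (quiet _ (≤-trans N≤s (m≤n+m s k)))) (guess-stable quiet N≤s k)

  mismatch≡0 : ∀ r e → x (append r e) ≢ t r → mismatch r e ≡ 0
  mismatch≡0 r e p with dist (x (append r e)) (t r) in eq
  ... | zero = ⊥-elim (p (dist≡0⇒≡ _ _ eq))
  ... | suc _ = refl

  quiet⇒constant : ∀ {N s} → Quiet N → N ≤ s → Constant (guess s)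
  quiet⇒constant {N} {s} quiet N≤s e with x (append (guess s) e) ≟ t (guess s)
  ... | yes p = p
  ... | no p = ⊥-elim (quiet (suc e + s) (≤-trans N≤s (m≤n+m s (suc e))) (trans
        (cong (λ r → refuted r (suc e + s)) (guess-stable quiet N≤s (suc e)))
        (search-complete _ (suc e + s) (s≤s (m≤m+n e s)) (mismatch≡0 (guess s) e p))))

  -- The guess moves up in single steps, so it could pass `r` only through a refutation of `r`
  -- itself.
  constant⇒bounded : ∀ {r} → Constant r → ∀ s → guess s ≤ r
  constant⇒bounded c zero = z≤n
  constant⇒bounded {r} c (suc s) with changed s in eq
  ... | suc _ = constant⇒bounded c s
  ... | zero with m≤n⇒m<n∨m≡n (constant⇒bounded c s)
  ...   | inj₁ p = p
  ...   | inj₂ refl with search-sound (mismatch (guess s)) s eq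
  ...     | e , _ , q with () ← trans (sym (cong (λ n → if0 n 1 0)
                (trans (cong (λ n → dist n (t (guess s))) (c e)) (dist-refl _)))) q

  restless⇒unbounded : Restless → ∀ k → Σ ℕ λ s → k ≤ guess s
  restless⇒unbounded inf zero = 0 , z≤n
  restless⇒unbounded inf (suc k) with restless⇒unbounded inf k
  ... | s , p with inf s
  ...   | s' , s≤s' , q = suc s' , subst (suc k ≤_) (sym (guess-changed s' q))
            (s≤s (≤-trans p (subst (λ m → guess s ≤ guess m) (m∸n+n≡m s≤s') (mono (s' ∸ s)))))
    where
    mono : ∀ k → guess s ≤ guess (k + s)
    mono zero = ≤-refl
    mono (suc k) = ≤-trans (mono k) (if0-elim (guess (k + s) ≤_) (changed (k + s)) (n≤1+n _) ≤-refl)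

  restless⇒¬constant : Restless → ∀ r → ¬ Constant r
  restless⇒¬constant inf r c with restless⇒unbounded inf (suc r)
  ... | s , p = <-irrefl refl (≤-trans p (constant⇒bounded c s))

  quiet-or-restless : ExcludedMiddle 0ℓ → Σ ℕ Quiet ⊎ Restless
  quiet-or-restless em with em {Σ ℕ Quiet}
  ... | yes q = inj₁ q
  ... | no ¬q = inj₂ inf
    where
    inf : Restless
    inf N with em {Σ ℕ λ s → N ≤ s × changed s ≡ 0}
    ... | yes p = p
    ... | no ¬p = ⊥-elim (¬q (N , λ s N≤s p → ¬p (s , N≤s , p)))

  LastChange : ℕ → Set
  LastChange N = Quiet N × ∀ M → suc M ≡ N → changed M ≡ 0

  -- Going down from a quiet stage, the first change met is the last one of all. If none is met, the
  -- stage 0 is quiet and satisfies the second condition vacuously.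
  last-change : ∀ N → Quiet N → Σ ℕ LastChange
  last-change zero quiet = 0 , quiet , λ _ ()
  last-change (suc N) quiet with changed N ≟ 0
  ... | yes p = suc N , quiet , λ { _ refl → p }
  ... | no p = last-change N λ s N≤s →
    [ quiet s , (λ { refl → p }) ]′ (m≤n⇒m<n∨m≡n N≤s)

  constant-above : ∀ {r} → Constant r → ∀ τ → dec r ⪯ τ → col x τ ≡ t r
  constant-above {r} c _ (υ , refl) = trans (cong x (trans (sym (append-enc (dec r) υ))
    (cong (λ n → append n (enc υ)) (enc-dec r)))) (c (enc υ))

  ¬constant⇒extension : ExcludedMiddle 0ℓ → (∀ r → ¬ Constant r) →
    ∀ ρ → Σ Str λ τ → ρ ⪯ τ × col x τ ≢ t (enc ρ)
  ¬constant⇒extension em ¬c ρ with em {Σ Str λ τ → ρ ⪯ τ × col x τ ≢ t (enc ρ)}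
  ... | yes p = p
  ... | no ¬p = ⊥-elim (¬c (enc ρ) λ e → same e (x (append (enc ρ) e) ≟ t (enc ρ)))
    where
    same : ∀ e → Dec (x (append (enc ρ) e) ≡ t (enc ρ)) → x (append (enc ρ) e) ≡ t (enc ρ)
    same e (yes q) = q
    same e (no q) = ⊥-elim (¬p (ρ ++ dec e , ⪯-++ ρ , λ q' → q (trans (cong x
      (trans (cong (append (enc ρ)) (sym (enc-dec e))) (append-enc ρ (dec e)))) q')))

  -- The bits of a string at the stages of change are folded with `op`. For V1 this keeps the last
  -- such bit; for V4 it multiplies them, so that color 1 means that all of them are 1.
  module Recoloring (op : ℕ → ℕ → ℕ) (a : ℕ) where

    step : Step
    step s b r = if0 (changed s) (op r b) r

    recolored : ℕ → ℕ
    recolored = foldCode step a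

    fold-quiet : ∀ {N} → Quiet N → ∀ s {r} υ → N ≤ s → foldStr step s r υ ≡ r
    fold-quiet quiet s [] _ = refl
    fold-quiet quiet s (b ∷ υ) N≤s with changed s in eq
    ... | zero = ⊥-elim (quiet s N≤s eq)
    ... | suc _ = fold-quiet quiet (suc s) υ (m≤n⇒m≤1+n N≤s)

    -- Appending the bit b at a stage where the guess changes overrides whatever color its
    -- first bits gave to the string.
    overwrite : ∀ σ {M} → length σ ≤ M → changed M ≡ 0 → ∀ b →
      Σ Str λ ρ → σ ⪯ ρ × Σ ℕ λ r → ∀ τ → ρ ⪯ τ →
        Σ Str λ υ → col recolored τ ≡ foldStr step (suc M) (op r (bit b)) υ
    overwrite σ {M} σ≤M p b with extend-to σ σ≤M
    ... | ρ , σ⪯ρ , refl = ρ ++ b ∷ [] , ⪯-trans σ⪯ρ (⪯-++ ρ) , foldStr step 0 a ρ ,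
      λ { _ (υ , refl) → υ , trans (foldCode-enc step a ((ρ ++ b ∷ []) ++ υ))
        (trans (cong (foldStr step 0 a) (++-assoc ρ (b ∷ []) υ))
        (trans (foldStr-++ step 0 a ρ (b ∷ υ))
          (cong (λ n → foldStr step (suc (length ρ)) n υ)
            (cong (λ n → if0 n (op (foldStr step 0 a ρ) (bit b)) (foldStr step 0 a ρ)) p)))) }

    recolored≤1 : a ≤ 1 → (∀ b {r} → r ≤ 1 → op r (bit b) ≤ 1) → IsColoring recolored
    recolored≤1 a≤1 op≤1 n = subst (_≤ 1)
      (trans (sym (foldCode-enc step a (dec n))) (cong recolored (enc-dec n)))
      (foldStr-invariant (_≤ 1) (λ s b q → if0-elim (_≤ 1) (changed s) (op≤1 b q) q) 0 (dec n) a≤1)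

module GuessComputable {I : Set} {o : I → Baire} (x : I → Baire) (t : I → ℕ → ℕ)
  (xᶜ : ∀ {n} {F : I → Vec ℕ n → ℕ} → Computable {o = o} F → Computable {o = o} λ i as → x i (F i as))
  (tᶜ : ∀ {n} {F : I → Vec ℕ n → ℕ} → Computable {o = o} F → Computable {o = o} λ i as → t i (F i as))
  where

  open module G (i : I) = Guess (x i) (t i)

  private variable
    n : ℕ
    F K : I → Vec ℕ n → ℕ

  refutedᶜ : Computable {o = o} F → Computable {o = o} K →
    Computable {o = o} λ i as → refuted i (F i as) (K i as)
  refutedᶜ = app₂ {F = λ i as → refuted i (lookup as 0F) (lookup as 1F)}
    (searchᶜ (if0ᶜ (distᶜ (xᶜ (appendᶜ (varᶜ 1F) (varᶜ 0F))) (tᶜ (varᶜ 1F))) oneᶜ zeroᶜ) (varᶜ 1F))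

  guessᶜ : Computable {o = o} F → Computable {o = o} λ i as → guess i (F i as)
  guessᶜ f = natrecᶜ zeroᶜ (if0ᶜ (refutedᶜ (varᶜ 1F) (varᶜ 0F)) (sucᶜ (varᶜ 1F)) (varᶜ 1F)) f

  recoloredᶜ : ∀ {op a} → Computable {o = o} (λ _ as → op (lookup as 0F) (lookup as 1F)) →
    Computable {o = o} (λ _ _ → a) →
    Computable {o = o} F → Computable {o = o} λ i as → Recoloring.recolored i op a (F i as)
  recoloredᶜ {op = op} opᶜ aᶜ f = foldCodeᶜ
    {S = λ i as → if0 (changed i (lookup as 0F)) (op (lookup as 2F) (lookup as 1F)) (lookup as 2F)}
    (if0ᶜ (refutedᶜ (guessᶜ (varᶜ 0F)) (varᶜ 0F))
      (app₂ {F = λ _ as → op (lookup as 0F) (lookup as 1F)} opᶜ (varᶜ 2F) (varᶜ 1F)) (varᶜ 2F)) aᶜ f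

flip : ∀ {n} → n ≤ 1 → Σ Bool λ b → bit b ≢ n
flip z≤n = true , λ ()
flip (s≤s z≤n) = false , λ ()

≢-unique : ∀ {m n k} → m ≤ 1 → n ≤ 1 → k ≤ 1 → m ≢ k → n ≢ k → m ≡ n
≢-unique z≤n z≤n _ _ _ = refl
≢-unique (s≤s z≤n) (s≤s z≤n) _ _ _ = refl
≢-unique z≤n (s≤s z≤n) z≤n p _ = ⊥-elim (p refl)
≢-unique z≤n (s≤s z≤n) (s≤s z≤n) _ q = ⊥-elim (q refl)
≢-unique (s≤s z≤n) z≤n z≤n _ q = ⊥-elim (q refl)
≢-unique (s≤s z≤n) z≤n (s≤s z≤n) p _ = ⊥-elim (p refl)

-- The reduction of V1 to V0

module V1≤V0 (em : ExcludedMiddle 0ℓ) where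

  module Solution (x : Baire) (xcol : IsColoring x) where
    open Guess x x public
    open Recoloring (λ _ b → b) 0 public

    recolored-coloring : IsColoring recolored
    recolored-coloring = recolored≤1 z≤n λ b _ → bit≤1 b

    -- If `σ` had length at most `M`, the stage of the last change, some extension of `σ` would have
    -- the bit other than `i` at this stage, and everything above it would keep that color.
    length≥ : ∀ {N i σ} → LastChange N → i ≤ 1 → DenseAbove recolored i σ → N ≤ length σ
    length≥ {zero} _ _ _ = z≤n
    length≥ {suc M} {i} {σ} (quiet , changes) i≤1 dense with suc M ≤? length σ
    ... | yes p = p
    ... | no p with flip i≤1
    ...   | b , b≢i with overwrite σ (≤-pred (≰⇒> p)) (changes M refl) b
    ...     | ρ , σ⪯ρ , _ , above with dense ρ σ⪯ρ
    ...       | τ , ρ⪯τ , τ-i with above τ ρ⪯τ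
    ...         | υ , q = ⊥-elim (b≢i (trans (sym (trans q (fold-quiet quiet (suc M) υ ≤-refl))) τ-i))

    -- No cone is constant, so above `ρ` lies a string whose color differs from that of `ρ`; one of
    -- the two has color `i`.
    both-dense : Restless → ∀ {i} → i ≤ 1 → Dense x i
    both-dense inf {i} i≤1 ρ _ with x (enc ρ) ≟ i
    ... | yes p = ρ , ⪯-refl , p
    ... | no p with ¬constant⇒extension em (restless⇒¬constant inf) ρ
    ...   | τ , ρ⪯τ , q = τ , ρ⪯τ , ≢-unique (xcol (enc τ)) i≤1 (xcol (enc ρ)) q (p ∘ sym)

    -- The stage `z 1` is the code of `σ`, hence at least the length of `σ`, by which the guess has
    -- settled if it ever does.
    output : Baire → Baire
    output z n = if0 n (x (guess (z 1))) (guess (z 1))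

    solution : ∀ z → Sol V0 recolored z → Sol V1 x (output z)
    solution z (i , σ , i≤1 , _ , z1≡ , dense) =
      x (guess (z 1)) , dec (guess (z 1)) , xcol _ , refl , sym (enc-dec (guess (z 1))) , cases
      where
      cases : (Dense x 0 × Dense x 1) ⊎
              (∀ τ → dec (guess (z 1)) ⪯ τ → col x τ ≡ x (guess (z 1)))
      cases with quiet-or-restless em
      ... | inj₂ inf = inj₁ (both-dense inf z≤n , both-dense inf ≤-refl)
      ... | inj₁ (N , quiet) with last-change N quiet
      ...   | N' , last = inj₂ (constant-above (quiet⇒constant (proj₁ last)
              (≤-trans (length≥ last i≤1 dense) (subst (length σ ≤_) (sym z1≡) (length≤enc σ)))))

  reduction : V1 ≤W V0
  reduction = ≤W-intro
    {G = λ (x , xcol) → Solution.recolored x xcol}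
    {W = λ a → Solution.output (input a) (input-inst a) (answer a)}
    (GuessComputable.recoloredᶜ proj₁ proj₁ orcᶜ orcᶜ {op = λ _ b → b} (varᶜ 1F) zeroᶜ (varᶜ 0F))
    (λ (x , xcol) → Solution.recolored-coloring x xcol)
    (if0ᶜ (varᶜ 0F) (inputᶜ guess1ᶜ) guess1ᶜ)
    (λ a → Solution.solution (input a) (input-inst a) (answer a) (answer-sol a))
    where
    guess1ᶜ = GuessComputable.guessᶜ input input inputᶜ inputᶜ (answerᶜ {n = 1} oneᶜ)

-- The reduction of V4 to V2

module V4≤V2 (em : ExcludedMiddle 0ℓ) where

  module Solution (x : Baire) (xcol : IsColoring x) where
    open Guess x (λ _ → 1) public
    open Recoloring _*_ 1 public

    recolored-coloring : IsColoring recolored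
    recolored-coloring = recolored≤1 ≤-refl λ b r≤1 → *-mono-≤ r≤1 (bit≤1 b)

    -- The bit `false` at a change makes the product 0, and no later factor can undo this.
    overwrite-0 : ∀ {σ M} → length σ ≤ M → changed M ≡ 0 → ¬ DenseAbove recolored 1 σ
    overwrite-0 {σ} {M} σ≤M p dense with overwrite σ σ≤M p false
    ... | ρ , σ⪯ρ , r , above with dense ρ σ⪯ρ
    ...   | τ , ρ⪯τ , τ-1 with above τ ρ⪯τ
    ...     | υ , q with () ← trans (sym τ-1) (trans q (foldStr-invariant {f = step} (_≡ 0)
                  (λ s b {r} r≡0 → if0-elim (_≡ 0) (changed s) (cong (_* bit b) r≡0) r≡0)
                  (suc M) υ (*-zeroʳ r)))

    length≥ : ∀ {N σ} → LastChange N → DenseAbove recolored 1 σ → N ≤ length σ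
    length≥ {zero} _ _ = z≤n
    length≥ {suc M} {σ} (_ , changes) dense with suc M ≤? length σ
    ... | yes p = p
    ... | no p = ⊥-elim (overwrite-0 (≤-pred (≰⇒> p)) (changes M refl) dense)

    fold-ones : ∀ s N → foldStr step s 1 (replicate N true) ≡ 1
    fold-ones s zero = refl
    fold-ones s (suc N) = trans
      (cong (λ r → foldStr step (suc s) r (replicate N true))
        (if0-elim (_≡ 1) (changed s) refl refl))
      (fold-ones (suc s) N)

    -- A string of `N` ones passes all changes with product 1, so the cone above it has color 1
    -- throughout.
    quiet⇒¬dense : ∀ {N} → Quiet N → ¬ Dense recolored 0
    quiet⇒¬dense {N} quiet dense with dense (replicate N true) (replicate N true , refl)
    ... | _ , (υ , refl) , p with () ← trans (sym p)
          (trans (foldCode-enc step 1 (replicate N true ++ υ))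
          (trans (foldStr-++ step 0 1 (replicate N true) υ)
          (trans (cong (λ r → foldStr step (length (replicate N true)) r υ) (fold-ones 0 N))
            (fold-quiet quiet (length (replicate N true)) υ
              (subst (N ≤_) (sym (length-replicate N)) ≤-refl)))))

    0-dense : Restless → Dense x 0
    0-dense inf ρ _ with ¬constant⇒extension em (restless⇒¬constant inf) ρ
    ... | τ , ρ⪯τ , p = τ , ρ⪯τ , ≢-unique (xcol (enc τ)) z≤n ≤-refl p λ ()

    output : Baire → Baire
    output z n = if0 n (z 0) (guess (z 1))

    solution : ∀ z → Sol V2 recolored z → Sol V4 x (output z)
    solution z (i , σ , i≤1 , z0≡ , z1≡ , if-0 , if-1) =
      i , dec (guess (z 1)) , i≤1 , z0≡ , sym (enc-dec (guess (z 1))) ,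
      dense , constant
      where
      dense : i ≡ 0 → Dense x 0
      dense i≡0 with quiet-or-restless em
      ... | inj₂ inf = 0-dense inf
      ... | inj₁ (N , quiet) = ⊥-elim (quiet⇒¬dense quiet (if-0 i≡0))
      constant : i ≡ 1 → ∀ τ → dec (guess (z 1)) ⪯ τ → col x τ ≡ 1
      constant i≡1 with quiet-or-restless em
      -- Some change occurs at a stage not below the length of `σ`, where an extension of `σ` can
      -- still be turned to 0.
      ... | inj₂ inf = let M , σ≤M , p = inf (length σ) in ⊥-elim (overwrite-0 σ≤M p (if-1 i≡1))
      ... | inj₁ (N , quiet) with last-change N quiet
      ...   | N' , last = constant-above (quiet⇒constant (proj₁ last)
              (≤-trans (length≥ last (if-1 i≡1)) (subst (length σ ≤_) (sym z1≡) (length≤enc σ))))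

  reduction : V4 ≤W V2
  reduction = ≤W-intro
    {G = λ (x , xcol) → Solution.recolored x xcol}
    {W = λ a → Solution.output (input a) (input-inst a) (answer a)}
    (GuessComputable.recoloredᶜ proj₁ (λ _ _ → 1) orcᶜ (λ _ → oneᶜ) {op = _*_}
      (varᶜ 0F *ᶜ varᶜ 1F) oneᶜ (varᶜ 0F))
    (λ (x , xcol) → Solution.recolored-coloring x xcol)
    (if0ᶜ (varᶜ 0F) (answerᶜ zeroᶜ)
      (GuessComputable.guessᶜ input (λ _ _ → 1) inputᶜ (λ _ → oneᶜ) (answerᶜ oneᶜ)))
    (λ a → Solution.solution (input a) (input-inst a) (answer a) (answer-sol a))

-- Inclusions of solution sets and the remaining reductions

V1⇒V0 : ∀ x z → Sol V1 x z → Sol V0 x z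
V1⇒V0 x z (i , σ , i≤1 , z0≡ , z1≡ , s) = i , σ , i≤1 , z0≡ , z1≡ , dense i≤1 s
  where
  dense : ∀ {i} → i ≤ 1 → (Dense x 0 × Dense x 1) ⊎ (∀ τ → σ ⪯ τ → col x τ ≡ i) → DenseAbove x i σ
  dense z≤n (inj₁ (d , _)) ρ _ = d ρ (ρ , refl)
  dense (s≤s z≤n) (inj₁ (_ , d)) ρ _ = d ρ (ρ , refl)
  dense _ (inj₂ c) ρ σ⪯ρ = ρ , ⪯-refl , c ρ σ⪯ρ

V2⇒V0 : ∀ x z → Sol V2 x z → Sol V0 x z
V2⇒V0 x z (i , σ , i≤1 , z0≡ , z1≡ , s) = i , σ , i≤1 , z0≡ , z1≡ , dense i≤1 s
  where
  dense : ∀ {i} → i ≤ 1 → (i ≡ 0 → Dense x 0) × (i ≡ 1 → DenseAbove x 1 σ) → DenseAbove x i σ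
  dense z≤n (d , _) ρ _ = d refl ρ (ρ , refl)
  dense (s≤s z≤n) (_ , d) = d refl

V3⇒V2 : ∀ x z → IsColoring x → Sol V3 x z → Sol V2 x z
V3⇒V2 x z xcol (i , σ , i≤1 , z0≡ , z1≡ , if-0 , if-1) =
  i , σ , i≤1 , z0≡ , z1≡ , if-0 , λ i≡1 ρ σ⪯ρ → dense (if-1 i≡1) ρ σ⪯ρ
  where
  -- The two immediate successors of `ρ` are incomparable, so they cannot both have color 0.
  dense : (∀ τ τ' → σ ⪯ τ → σ ⪯ τ' → col x τ ≡ 0 → col x τ' ≡ 0 → τ ⪯ τ' ⊎ τ' ⪯ τ) → DenseAbove x 1 σ
  dense chain ρ σ⪯ρ with coloring-cases (xcol (enc (ρ ++ false ∷ [])))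
                       | coloring-cases (xcol (enc (ρ ++ true ∷ [])))
  ... | inj₂ p | _ = ρ ++ false ∷ [] , ⪯-++ ρ , p
  ... | _ | inj₂ p = ρ ++ true ∷ [] , ⪯-++ ρ , p
  ... | inj₁ p | inj₁ q with chain _ _ (⪯-trans σ⪯ρ (⪯-++ ρ)) (⪯-trans σ⪯ρ (⪯-++ ρ)) p q
  ...   | inj₁ r with () ← snoc-⪯-head ρ r ⪯-refl
  ...   | inj₂ r with () ← snoc-⪯-head ρ r ⪯-refl

V4⇒V3 : ∀ x z → Sol V4 x z → Sol V3 x z
V4⇒V3 x z (i , σ , i≤1 , z0≡ , z1≡ , if-0 , if-1) =
  i , σ , i≤1 , z0≡ , z1≡ , if-0 , λ i≡1 τ τ' σ⪯τ _ p _ → ⊥-elim (1≢0 (trans (sym (if-1 i≡1 τ σ⪯τ)) p))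
  where
  1≢0 : 1 ≢ 0
  1≢0 ()

V0≡V1 : ExcludedMiddle 0ℓ → V0 ≡W V1
V0≡V1 em =
  ≤W-mono {V0} {V0} {V0} {V1} (λ _ p → p) (λ _ _ _ s → s) (λ _ p → p) (λ y z _ → V1⇒V0 y z) ≤W-refl ,
  V1≤V0.reduction em

V1≤V2 : ExcludedMiddle 0ℓ → V1 ≤W V2
V1≤V2 em = ≤W-mono {V1} {V1} {V0} {V2} (λ _ p → p) (λ _ _ _ s → s) (λ _ p → p) (λ y z _ → V2⇒V0 y z)
  (V1≤V0.reduction em)

-- The direction from V3 to V2 reuses the reduction of V4, whose solutions also solve V3.
V2≡V3 : ExcludedMiddle 0ℓ → V2 ≡W V3
V2≡V3 em =
  ≤W-mono {V2} {V2} {V2} {V3} (λ _ p → p) (λ _ _ _ s → s) (λ _ p → p) V3⇒V2 ≤W-refl ,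
  ≤W-mono {V4} {V3} {V2} {V2} (λ _ p → p) (λ x z _ → V4⇒V3 x z) (λ _ p → p)
    (λ _ _ _ s → s) (V4≤V2.reduction em)

V3≡V4 : ExcludedMiddle 0ℓ → V3 ≡W V4
V3≡V4 em =
  ≤W-mono {V3} {V3} {V3} {V4} (λ _ p → p) (λ _ _ _ s → s) (λ _ p → p) (λ y z _ → V4⇒V3 y z) ≤W-refl ,
  ≤W-mono {V4} {V4} {V2} {V3} (λ _ p → p) (λ _ _ _ s → s) (λ _ p → p) V3⇒V2 (V4≤V2.reduction em)

-- Non-reductions

Coloring : Set
Coloring = Σ Baire IsColoring

col′ : Coloring → Str → ℕ
col′ X = col (proj₁ X)

splicedAt : (Str → ℕ) → ℕ → Baire → Baire
splicedAt φ v x n with n <? v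
... | yes _ = x n
... | no _ = φ (dec n)

splice : ℕ → Coloring → (φ : Str → ℕ) → (∀ σ → φ σ ≤ 1) → Coloring
splice v (x , xcol) φ φ≤1 = splicedAt φ v x , bound
  where
  bound : IsColoring (splicedAt φ v x)
  bound n with n <? v
  ... | yes _ = xcol n
  ... | no _ = φ≤1 (dec n)

module _ (v : ℕ) (X : Coloring) {φ : Str → ℕ} (φ≤1 : ∀ σ → φ σ ≤ 1) where

  splice-agree : Agree v (proj₁ X) (proj₁ (splice v X φ φ≤1))
  splice-agree n n<v with n <? v
  ... | yes _ = refl
  ... | no n≮v = ⊥-elim (n≮v n<v)

  splice-beyond : ∀ τ → v ≤ length τ → col′ (splice v X φ φ≤1) τ ≡ φ τ
  splice-beyond τ v≤τ with enc τ <? v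
  ... | yes p = ⊥-elim (<⇒≱ p (≤-trans v≤τ (length≤enc τ)))
  ... | no _ = cong φ (dec-enc τ)

  splice-elim : (Q : ℕ → Set) → ∀ τ → Q (col′ X τ) → Q (φ τ) → Q (col′ (splice v X φ φ≤1) τ)
  splice-elim Q τ p q with enc τ <? v
  ... | yes _ = p
  ... | no _ = subst (Q ∘ φ) (sym (dec-enc τ)) q

-- What the non-reductions need from a Weihrauch reduction: both functionals depend on finite parts
-- of their oracles. An answer obtained from `z` is read off two output values, so it persists for
-- all nearby instances and solutions.
record ContinuousReduction (R : Baire → ℕ → Str → Set) (Q : Problem) : Set where
  field
    image : Coloring → Coloring

  Solves : Coloring → Baire → Set
  Solves X = Sol Q (proj₁ (image X))

  field
    image-use : ∀ X n → Σ ℕ λ u → ∀ X' → Agree u (proj₁ X) (proj₁ X') →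
      proj₁ (image X') n ≡ proj₁ (image X) n
    answer-use : ∀ X z → Solves X z → Σ ℕ λ i → Σ Str λ σ → i ≤ 1 × R (proj₁ X) i σ ×
      Σ ℕ λ u → ∀ X' z' → Agree u (proj₁ X) (proj₁ X') → Agree u z z' → Solves X' z' →
        R (proj₁ X') i σ

≤W⇒continuous : ∀ {P Q} {R : Baire → ℕ → Str → Set} →
  (∀ x → IsColoring x → Inst P x) → (∀ y → Inst Q y → IsColoring y) →
  (∀ x z → Sol P x z → PairSol (R x) z) → P ≤W Q → ContinuousReduction R Q
≤W⇒continuous {P} {Q} {R} instP instQ solP (Φ , Ψ , red) = record
  { image = image ; image-use = image-use ; answer-use = answer-use }
  where
  module Red (X : Coloring) where
    result = red (proj₁ X) (instP (proj₁ X) (proj₂ X))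
    y = proj₁ result
    evaluates = proj₁ (proj₂ result)
    y-inst = proj₁ (proj₂ (proj₂ result))
    back = proj₂ (proj₂ (proj₂ result))

  image : Coloring → Coloring
  image X = Red.y X , instQ _ (Red.y-inst X)

  Solves : Coloring → Baire → Set
  Solves X = Sol Q (proj₁ (image X))

  image-use : ∀ X n → Σ ℕ λ u → ∀ X' → Agree u (proj₁ X) (proj₁ X') →
    proj₁ (image X') n ≡ proj₁ (image X) n
  image-use X n with eval-use (Red.evaluates X n)
  ... | u , stable = u , λ X' p → eval-deterministic (Red.evaluates X' n) (stable (proj₁ X') p)

  answer-use : ∀ X z → Solves X z → Σ ℕ λ i → Σ Str λ σ → i ≤ 1 × R (proj₁ X) i σ ×
    Σ ℕ λ u → ∀ X' z' → Agree u (proj₁ X) (proj₁ X') → Agree u z z' → Solves X' z' → R (proj₁ X') i σ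
  answer-use X z s with Red.back X z s
  ... | w , ev , t with solP _ w t
  ...   | i , σ , i≤1 , w0≡ , w1≡ , r with eval-use (ev 0) | eval-use (ev 1)
  ...     | u , stable0 | v , stable1 = i , σ , i≤1 , r , u ⊔ v , same
    where
    same : ∀ X' z' → Agree (u ⊔ v) (proj₁ X) (proj₁ X') → Agree (u ⊔ v) z z' → Solves X' z' →
      R (proj₁ X') i σ
    same X' z' p q s' with Red.back X' z' s'
    ... | w' , ev' , t' with solP _ w' t'
    ...   | i' , σ' , _ , w'0≡ , w'1≡ , r' = subst₂ (R (proj₁ X'))
      (trans (sym w'0≡) (trans (eval-deterministic (ev' 0) (stable0 _ (agree-≤ (m≤m⊔n u v) p⊕q))) w0≡))
      (enc-injective σ' σ (trans (sym w'1≡)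
        (trans (eval-deterministic (ev' 1) (stable1 _ (agree-≤ (m≤n⊔m u v) p⊕q))) w1≡)))
      r'
      where
      p⊕q : Agree (u ⊔ v) (proj₁ X ⊕ z) (proj₁ X' ⊕ z')
      p⊕q = ⊕-agree p q

padded-length : ∀ (σ : Str) k → k ≤ length (σ ++ replicate k false)
padded-length σ k = ≤-trans (≤-reflexive (sym (length-replicate k)))
  (≤-trans (m≤n+m _ (length σ)) (≤-reflexive (sym (length-++ σ))))

avoids⇒constant : ∀ (X : Coloring) {i ρ} → i ≤ 1 → (∀ τ → ρ ⪯ τ → col′ X τ ≢ i) →
  ∀ τ → ρ ⪯ τ → col′ X τ ≡ col′ X ρ
avoids⇒constant (x , xcol) i≤1 avoids τ ρ⪯τ =
  ≢-unique (xcol _) (xcol _) i≤1 (avoids τ ρ⪯τ) (avoids _ ⪯-refl)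

-- V2 does not reduce to V1

module V2≰V1 (em : ExcludedMiddle 0ℓ)
  (red : ContinuousReduction (λ x i σ → (i ≡ 0 → Dense x 0) × (i ≡ 1 → DenseAbove x 1 σ)) V1) where

  open ContinuousReduction red

  pair : ℕ → Str → Baire
  pair i σ n = if0 n i (enc σ)

  V1-solution : ∀ (Y : Coloring) → Σ Baire (Sol V1 (proj₁ Y))
  V1-solution Y with em {Σ Str λ σ → ∀ τ → σ ⪯ τ → col′ Y τ ≡ col′ Y σ}
  ... | yes (σ , c) = pair (col′ Y σ) σ , col′ Y σ , σ , proj₂ Y _ , refl , refl , inj₂ c
  ... | no ¬c = pair 0 [] , 0 , [] , z≤n , refl , refl , inj₁ (dense z≤n , dense ≤-refl)
    where
    dense : ∀ {i} → i ≤ 1 → Dense (proj₁ Y) i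
    dense {i} i≤1 ρ _ with em {Σ Str λ τ → ρ ⪯ τ × col′ Y τ ≡ i}
    ... | yes p = p
    ... | no ¬p = ⊥-elim (¬c (ρ , avoids⇒constant Y i≤1 λ τ ρ⪯τ q → ¬p (τ , ρ⪯τ , q)))

  -- The root is nonempty, so a whole cone, above the other one-bit string, lies outside; there
  -- `outside` is 1, and 0 is not dense for it.
  module Cone (b : Bool) (s : Str) where

    root : Str
    root = b ∷ s

    Vanishes : Coloring → Set
    Vanishes X = ∀ τ → root ⪯ τ → col′ X τ ≡ 0

    outside : Str → ℕ
    outside τ with root ⪯? τ
    ... | yes _ = 0
    ... | no _ = 1

    outside≤1 : ∀ τ → outside τ ≤ 1
    outside≤1 τ with root ⪯? τ
    ... | yes _ = z≤n
    ... | no _ = ≤-refl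

    outside-in : ∀ {τ} → root ⪯ τ → outside τ ≡ 0
    outside-in {τ} p with root ⪯? τ
    ... | yes _ = refl
    ... | no ¬p = ⊥-elim (¬p p)

    outside-out : ∀ {τ} → ¬ root ⪯ τ → outside τ ≡ 1
    outside-out {τ} ¬p with root ⪯? τ
    ... | yes p = ⊥-elim (¬p p)
    ... | no _ = refl

    -- If the image were forced to be `j` above `σ`, then `pair j σ` would solve it for every such
    -- `X'`. For `X₁` the color 0 is not dense, so the answer has color 1; `X₂` keeps the use of
    -- this answer and is 0 from there on, which refutes it.
    ¬forced : ∀ X v j σ → Vanishes X → j ≤ 1 →
      ¬ (∀ X' → Vanishes X' → Agree v (proj₁ X) (proj₁ X') → ∀ τ → σ ⪯ τ → col′ (image X') τ ≡ j)
    ¬forced X v j σ X-van j≤1 forced = refute (answer-use X₁ z (solves X₁ X₁-van X₁-agree))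
      where
      z = pair j σ
      X₁ = splice v X outside outside≤1
      X₁-agree : Agree v (proj₁ X) (proj₁ X₁)
      X₁-agree = splice-agree v X outside≤1
      X₁-van : Vanishes X₁
      X₁-van τ p = splice-elim v X outside≤1 (_≡ 0) τ (X-van τ p) (outside-in p)
      solves : ∀ X' → Vanishes X' → Agree v (proj₁ X) (proj₁ X') → Solves X' z
      solves X' van p = j , σ , j≤1 , refl , refl , inj₂ (forced X' van p)
      ¬dense : ¬ Dense (proj₁ X₁) 0
      ¬dense dense with flip (bit≤1 b)
      ... | c , c≢b with dense (c ∷ replicate v false) (c ∷ replicate v false , refl)
      ...   | τ@(d ∷ _) , p , τ-0 with ⪯-uncons p
      ...     | refl , _ with () ← trans (sym τ-0) (trans
                  (splice-beyond v X outside≤1 τ (≤-trans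
                    (subst (_≤ suc (length (replicate v false))) (length-replicate v) (n≤1+n _))
                    (⪯-length p)))
                  (outside-out λ q → c≢b (cong bit (sym (proj₁ (⪯-uncons q))))))
      refute : (Σ ℕ λ i → Σ Str λ σ → i ≤ 1 ×
        ((i ≡ 0 → Dense (proj₁ X₁) 0) × (i ≡ 1 → DenseAbove (proj₁ X₁) 1 σ)) ×
        Σ ℕ λ u → ∀ X' z' → Agree u (proj₁ X₁) (proj₁ X') → Agree u z z' → Solves X' z' →
          (i ≡ 0 → Dense (proj₁ X') 0) × (i ≡ 1 → DenseAbove (proj₁ X') 1 σ)) → ⊥
      refute (i , ρ , i≤1 , (if-0 , _) , u , stable) with coloring-cases i≤1
      ... | inj₁ i≡0 = ¬dense (if-0 i≡0)
      ... | inj₂ i≡1 = finite (proj₂ (stable X₂ z (agree-≤ (m≤n⊔m v u) X₂-agree) (λ _ _ → refl)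
                         (solves X₂ X₂-van (agree-trans {β = proj₁ X₁} X₁-agree
                           (agree-≤ (m≤m⊔n v u) X₂-agree)))) i≡1)
        where
        X₂ = splice (v ⊔ u) X₁ (λ _ → 0) (λ _ → z≤n)
        X₂-agree : Agree (v ⊔ u) (proj₁ X₁) (proj₁ X₂)
        X₂-agree = splice-agree (v ⊔ u) X₁ (λ _ → z≤n)
        X₂-van : Vanishes X₂
        X₂-van τ p = splice-elim (v ⊔ u) X₁ {λ _ → 0} (λ _ → z≤n) (_≡ 0) τ (X₁-van τ p) refl
        finite : ¬ DenseAbove (proj₁ X₂) 1 ρ
        finite dense with dense (ρ ++ replicate (v ⊔ u) false) (⪯-++ ρ)
        ... | τ , p , τ-1 with () ← trans (sym τ-1) (splice-beyond (v ⊔ u) X₁ {λ _ → 0} (λ _ → z≤n) τ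
              (≤-trans (padded-length ρ (v ⊔ u)) (⪯-length p)))

    -- A forcing condition. Only the first `size` values of the sample constrain extensions; the
    -- sample as a whole shows them to be compatible with vanishing on the cone.
    record Condition : Set where
      constructor _upto_given_
      field
        sample : Coloring
        size : ℕ
        vanishes : Vanishes sample
    open Condition

    _extends_ : Coloring → Condition → Set
    X extends p = Agree (size p) (proj₁ (sample p)) (proj₁ X)

    _⊒_ : Condition → Condition → Set
    q ⊒ p = size p ≤ size q × sample q extends p

    ⊒-trans : ∀ {p q r} → r ⊒ q → q ⊒ p → r ⊒ p
    ⊒-trans {q = q} (l , a) (l' , a') =
      ≤-trans l' l , agree-trans {β = proj₁ (sample q)} a' (agree-≤ l' a)

    Meets : ℕ → Str → Coloring → Set
    Meets i σ X = Σ Str λ τ → σ ⪯ τ × col′ (image X) τ ≢ i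

    Forces : Condition → ℕ → Str → Set
    Forces p i σ = ∀ X → Vanishes X → X extends p → Meets i σ X

    -- By `¬forced`, some extension of `p` has an image with a color other than `i` above `σ`. The
    -- use of this single value of the image makes it a condition.
    force : ∀ p i σ → i ≤ 1 → Σ Condition λ q → q ⊒ p × Forces q i σ
    force p i σ i≤1 with em {Σ Coloring λ X → Vanishes X × X extends p × Meets i σ X}
    ... | yes (X , van , ext , τ , σ⪯τ , τ≢i) with image-use X (enc τ)
    ...   | u , stable = X upto (size p ⊔ u) given van , (m≤m⊔n _ u , ext) , λ X' van' ext' →
              τ , σ⪯τ , λ eq → τ≢i (trans (sym (stable X' (agree-≤ (m≤n⊔m (size p) u) ext'))) eq)
    force p i σ i≤1 | no ¬q = ⊥-elim (¬forced (sample p) (size p) i σ (vanishes p) i≤1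
      λ X van ext τ σ⪯τ → same X van ext τ σ⪯τ (col′ (image X) τ ≟ i))
      where
      same : ∀ X → Vanishes X → X extends p → ∀ τ → σ ⪯ τ → Dec (col′ (image X) τ ≡ i) →
        col′ (image X) τ ≡ i
      same X van ext τ σ⪯τ (yes eq) = eq
      same X van ext τ σ⪯τ (no neq) = ⊥-elim (¬q (X , van , ext , τ , σ⪯τ , neq))

    module Generic (start : Condition) where

      refine : ∀ k p → Σ Condition λ q → q ⊒ p × k < size q × (∀ {i} → i ≤ 1 → Forces q i (dec k))
      refine k p with force p 0 (dec k) z≤n
      ... | q , q⊒p , f with force q 1 (dec k) ≤-refl
      ...   | r , r⊒q , g =
              r′ , (≤-trans (proj₁ r⊒p) (m≤m⊔n _ _) , proj₂ r⊒p) , m≤n⊔m (size r) (suc k) , forces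
        where
        -- The size exceeds `k`, so the value at `k` is settled from this stage on and the limit is
        -- well determined.
        r′ = sample r upto (size r ⊔ suc k) given vanishes r
        r⊒p = ⊒-trans {p} {q} {r} r⊒q q⊒p
        r′⊒r : ∀ {X} → X extends r′ → X extends r
        r′⊒r = agree-≤ (m≤m⊔n (size r) (suc k))
        forces : ∀ {i} → i ≤ 1 → Forces r′ i (dec k)
        forces z≤n X van ext = f X van
          (agree-trans {β = proj₁ (sample r)} (proj₂ r⊒q) (agree-≤ (proj₁ r⊒q) (r′⊒r {X} ext)))
        forces (s≤s z≤n) X van ext = g X van (r′⊒r {X} ext)

      conditions : ℕ → Condition
      conditions zero = start
      conditions (suc k) = proj₁ (refine k (conditions k))

      conditions-⊒ : ∀ k m → conditions (k + m) ⊒ conditions m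
      conditions-⊒ zero m = ≤-refl , λ _ _ → refl
      conditions-⊒ (suc k) m = ⊒-trans {conditions m} {conditions (k + m)} {conditions (suc k + m)}
        (proj₁ (proj₂ (refine (k + m) (conditions (k + m))))) (conditions-⊒ k m)

      conditions-mono : ∀ {m k} → m ≤ k → conditions k ⊒ conditions m
      conditions-mono {m} {k} m≤k =
        subst (λ n → conditions n ⊒ conditions m) (m∸n+n≡m m≤k) (conditions-⊒ (k ∸ m) m)

      limit : Coloring
      limit = (λ n → proj₁ (sample (conditions (suc n))) n) ,
              λ n → proj₂ (sample (conditions (suc n))) n

      limit-vanishes : Vanishes limit
      limit-vanishes τ = vanishes (conditions (suc (enc τ))) τ

      limit-extends : ∀ k → limit extends conditions k
      limit-extends k n n<size with ≤-total k (suc n)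
      ... | inj₁ k≤n = proj₂ (conditions-mono k≤n) n n<size
      ... | inj₂ n<k = sym (proj₂ (conditions-mono n<k) n
                       (proj₁ (proj₂ (proj₂ (refine n (conditions n))))))

      limit-meets : ∀ {i} → i ≤ 1 → ∀ σ → Meets i σ limit
      limit-meets {i} i≤1 σ = subst (λ ρ → Meets i ρ limit) (dec-enc σ)
        (proj₂ (proj₂ (proj₂ (refine k (conditions k)))) i≤1 limit
          limit-vanishes (limit-extends (suc k)))
        where k = enc σ

      image-dense : ∀ {i} → i ≤ 1 → Dense (proj₁ (image limit)) i
      image-dense {i} i≤1 ρ _ with flip i≤1
      ... | b , b≢i with limit-meets (bit≤1 b) ρ
      ...   | τ , ρ⪯τ , p = τ , ρ⪯τ , ≢-unique (proj₂ (image limit) _) i≤1 (bit≤1 b) p (b≢i ∘ sym)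

  ones : Coloring
  ones = (λ _ → 1) , λ _ → ≤-refl

  absurd : ⊥
  absurd with V1-solution (image ones)
  ... | z , s@(j , ρ , j≤1 , z0≡ , z1≡ , _) with answer-use ones z s
  ...   | i , σ , i≤1 , (if-0 , _) , u , stable with coloring-cases i≤1
  ...     | inj₁ i≡0 with () ← proj₂ (proj₂ (if-0 i≡0 [] ⪯-refl))
  -- The padding puts the cone beyond the use `u`, where `ones` may be changed; `suc` makes the root
  -- nonempty even for `u` equal to 0.
  ...     | inj₂ i≡1 = not-1 (σ ++ replicate (suc u) false) refl
    where
    not-1 : ∀ σ' → σ ++ replicate (suc u) false ≡ σ' → ⊥
    not-1 [] eq = <⇒≱ z<s (subst (λ τ → suc u ≤ length τ) eq (padded-length σ (suc u)))
    -- With both colors dense in the image of the limit, every pair solves it. So `z` still does,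
    -- and the answer given for `ones` has to persist.
    not-1 (b ∷ s) eq = conflict (proj₂ (stable limit z agree (λ _ _ → refl)
        (j , ρ , j≤1 , z0≡ , z1≡ , inj₁ (image-dense z≤n , image-dense ≤-refl))) i≡1)
      where
      open Cone b s
      long : suc u ≤ length root
      long = subst (λ τ → suc u ≤ length τ) eq (padded-length σ (suc u))
      start : Condition
      start = splice 0 ones outside outside≤1 upto u given
        λ τ p → trans (splice-beyond 0 ones outside≤1 τ z≤n) (outside-in p)
      open Generic start
      agree : Agree u (λ _ → 1) (proj₁ limit)
      agree n n<u = trans (sym (outside-out λ p → <⇒≱ (<-trans n<u (≤-trans long (⪯-length p)))
          (subst (length (dec n) ≤_) (enc-dec n) (length≤enc (dec n)))))
        (limit-extends 0 n n<u)
      conflict : ¬ DenseAbove (proj₁ limit) 1 σ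
      conflict dense with dense root (_ , eq)
      ... | τ , p , τ-1 with () ← trans (sym τ-1) (limit-vanishes τ p)

V2≰V1 : ExcludedMiddle 0ℓ → ¬ (V2 ≤W V1)
V2≰V1 em red = V2≰V1.absurd em (≤W⇒continuous (λ _ p → p) (λ _ p → p) (λ _ _ s → s) red)

-- V0 does not reduce to TT12

enc-bound : ∀ σ → 2 + enc σ ≤ 2 ^ suc (length σ)
enc-bound [] = ≤-refl
enc-bound (b ∷ σ) = ≤-trans (step b) (*-monoʳ-≤ 2 (enc-bound σ))
  where
  double : ∀ n → 2 * (2 + n) ≡ 2 + (2 + 2 * n)
  double = solve-∀
  step : ∀ b → 2 + enc (b ∷ σ) ≤ 2 * (2 + enc σ)
  step false = ≤-trans (n≤1+n _) (≤-reflexive (sym (double (enc σ))))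
  step true = ≤-reflexive (sym (double (enc σ)))

bitAt : ℕ → Str → ℕ
bitAt _ [] = 0
bitAt zero (b ∷ _) = bit b
bitAt (suc k) (_ ∷ σ) = bitAt k σ

bitAt≤1 : ∀ k σ → bitAt k σ ≤ 1
bitAt≤1 _ [] = z≤n
bitAt≤1 zero (b ∷ _) = bit≤1 b
bitAt≤1 (suc k) (_ ∷ σ) = bitAt≤1 k σ

bitAt-snoc : ∀ ρ b {τ} → (ρ ++ b ∷ []) ⪯ τ → bitAt (length ρ) τ ≡ bit b
bitAt-snoc [] b (υ , refl) = refl
bitAt-snoc (_ ∷ ρ) b (υ , refl) = bitAt-snoc ρ b (υ , refl)

-- The trees that graft substitutes for the subtrees of h rooted at level k.
Scions : ℕ → Set
Scions k = ∀ (τ : Str) → length τ ≡ k → Str → Str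

cons-scions : ∀ {k} → Bool → Scions (suc k) → Scions k
cons-scions b T τ p = T (b ∷ τ) (cong suc p)

graft : ∀ k → (Str → Str) → Scions k → Str → Str
graft zero h T σ = T [] refl σ
graft (suc k) h T [] = h []
graft (suc k) h T (b ∷ σ) = graft k (h ∘ (b ∷_)) (cons-scions b T) σ

graft-below : ∀ k h (T : Scions k) σ → length σ < k → graft k h T σ ≡ h σ
graft-below (suc k) h T [] _ = refl
graft-below (suc k) h T (b ∷ σ) (s≤s p) = graft-below k (h ∘ (b ∷_)) (cons-scions b T) σ p

graft-elim : ∀ k h (T : Scions k) (Q : Str → Set) → (∀ σ → length σ < k → Q (h σ)) →
  (∀ (τ : Str) p υ → Q (T τ p υ)) → ∀ σ → Q (graft k h T σ)
graft-elim zero h T Q below above σ = above [] refl σ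
graft-elim (suc k) h T Q below above [] = below [] z<s
graft-elim (suc k) h T Q below above (b ∷ σ) =
  graft-elim k (h ∘ (b ∷_)) (cons-scions b T) Q (λ σ p → below (b ∷ σ) (s≤s p))
    (λ τ p → above (b ∷ τ) (cong suc p)) σ

graft-root : ∀ k h (T : Scions k) → IsEmbedding h → (∀ (τ : Str) p υ → h τ ⪯ T τ p υ) →
  ∀ σ → h [] ⪯ graft k h T σ
graft-root k h T emb above = graft-elim k h T (h [] ⪯_) (λ σ _ → proj₁ (emb [] σ) (σ , refl))
  λ τ p υ → ⪯-trans (proj₁ (emb [] τ) (τ , refl)) (above τ p υ)

graft-embedding : ∀ k h (T : Scions k) → IsEmbedding h → (∀ (τ : Str) p → IsEmbedding (T τ p)) →
  (∀ (τ : Str) p υ → h τ ⪯ T τ p υ) → IsEmbedding (graft k h T)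
graft-embedding zero h T emb embT above = embT [] refl
graft-embedding (suc k) h T emb embT above = go
  where
  root : ∀ b σ → h (b ∷ []) ⪯ graft k (h ∘ (b ∷_)) (cons-scions b T) σ
  root b = graft-root k (h ∘ (b ∷_)) (cons-scions b T) (embedding-cons h b emb)
    (λ τ p → above (b ∷ τ) (cong suc p))
  sub : ∀ b → IsEmbedding (graft k (h ∘ (b ∷_)) (cons-scions b T))
  sub b = graft-embedding k (h ∘ (b ∷_)) (cons-scions b T) (embedding-cons h b emb)
    (λ τ p → embT (b ∷ τ) (cong suc p))
    (λ τ p → above (b ∷ τ) (cong suc p))
  go : IsEmbedding (graft (suc k) h T)
  go [] τ = (λ _ → graft-root (suc k) h T emb above τ) , λ _ → τ , refl
  go (b ∷ σ) [] = (λ ()) , λ p → ⊥-elim (snoc-⋠ [] (proj₂ (emb (b ∷ []) []) (⪯-trans (root b σ) p)))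
  go (b ∷ σ) (c ∷ τ) = to , from
    where
    to : (b ∷ σ) ⪯ (c ∷ τ) → graft (suc k) h T (b ∷ σ) ⪯ graft (suc k) h T (c ∷ τ)
    to p with ⪯-uncons p
    ... | refl , q = proj₁ (sub b σ τ) q
    -- Both `h (b ∷ [])` and `h (c ∷ [])` lie below the second node, so they are comparable, which
    -- forces `b ≡ c` as `h` is an embedding.
    heads : graft (suc k) h T (b ∷ σ) ⪯ graft (suc k) h T (c ∷ τ) → b ≡ c
    heads p with ⪯-linear _ _ (⪯-trans (root b σ) p) (root c τ)
    ... | inj₁ q = proj₁ (⪯-uncons (proj₂ (emb (b ∷ []) (c ∷ [])) q))
    ... | inj₂ q = sym (proj₁ (⪯-uncons (proj₂ (emb (c ∷ []) (b ∷ [])) q)))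
    from : graft (suc k) h T (b ∷ σ) ⪯ graft (suc k) h T (c ∷ τ) → (b ∷ σ) ⪯ (c ∷ τ)
    from p with heads p
    ... | refl = ⪯-cons (proj₂ (sub b σ τ) p)

MonochromaticTree : Baire → ℕ → Str → (Str → Str) → Set
MonochromaticTree y c ρ h = IsEmbedding h × ∀ υ → ρ ⪯ h υ × col y (h υ) ≡ c

dense⇒tree : ∀ y c ρ → DenseAbove y c ρ → Σ (Str → Str) (MonochromaticTree y c ρ)
dense⇒tree y c ρ dense = tree ρ , tree-embedding ρ , λ υ →
  tree-property (ρ ⪯_) (λ p q → ⪯-trans q p) (λ τ → ρ ⪯ τ × col y τ ≡ c) color ρ υ ⪯-refl
  where
  -- Off the cone above `ρ` density says nothing; the default there is never met, as the tree starts
  -- at `ρ`.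
  next : Str → Str
  next σ with ρ ⪯? σ
  ... | yes p = proj₁ (dense σ p)
  ... | no _ = σ
  ⪯-next : ∀ σ → σ ⪯ next σ
  ⪯-next σ with ρ ⪯? σ
  ... | yes p = proj₁ (proj₂ (dense σ p))
  ... | no _ = ⪯-refl
  color : ∀ σ → ρ ⪯ σ → ρ ⪯ next σ × col y (next σ) ≡ c
  color σ p with ρ ⪯? σ
  ... | yes q = ⪯-trans p (proj₁ (proj₂ (dense σ q))) , proj₂ (proj₂ (dense σ q))
  ... | no ¬q = ⊥-elim (¬q p)
  open Tree next ⪯-next

module V0≰TT12 (em : ExcludedMiddle 0ℓ) (red : ContinuousReduction DenseAbove TT12) where

  open ContinuousReduction red

  range : (Str → Str) → Baire
  range h n with em {Σ Str λ σ → h σ ≡ dec n}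
  ... | yes _ = 1
  ... | no _ = 0

  range-sound : ∀ h τ → τ ∈H range h → Σ Str λ σ → h σ ≡ τ
  range-sound h τ p with em {Σ Str λ σ → h σ ≡ dec (enc τ)}
  ... | yes (σ , q) = σ , trans q (dec-enc τ)

  range-complete : ∀ h σ → h σ ∈H range h
  range-complete h σ with em {Σ Str λ σ' → h σ' ≡ dec (enc (h σ))}
  ... | yes _ = refl
  ... | no ¬p = ⊥-elim (¬p (σ , sym (dec-enc (h σ))))

  range≤1 : ∀ h n → range h n ≤ 1
  range≤1 h n with em {Σ Str λ σ → h σ ≡ dec n}
  ... | yes _ = ≤-refl
  ... | no _ = z≤n

  range-solves : ∀ X h c ρ → MonochromaticTree (proj₁ (image X)) c ρ h → Solves X (range h)
  range-solves X h c ρ (emb , mono) = range≤1 h ,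
    (h , range-complete h , range-sound h , emb) , c , color
    where
    color : ∀ τ → τ ∈H range h → col′ (image X) τ ≡ c
    color τ p with range-sound h τ p
    ... | σ , refl = proj₂ (mono σ)

  short : ∀ h → IsEmbedding h → ∀ {σ n u} → h σ ≡ dec n → n < u → length σ < u
  short h emb {σ} {n} p n<u = ≤-<-trans (embedding-length h emb σ) (≤-<-trans
    (≤-trans (length≤enc (h σ)) (≤-reflexive (trans (cong enc p) (enc-dec n)))) n<u)

  -- A node with code below `u` is the image of a string shorter than `u`, because embeddings do not
  -- decrease length.
  range-agree : ∀ h h' {u} → IsEmbedding h → IsEmbedding h' →
    (∀ σ → length σ < u → h σ ≡ h' σ) → Agree u (range h) (range h')
  range-agree h h' emb emb' same n n<u
    with em {Σ Str λ σ → h σ ≡ dec n} | em {Σ Str λ σ → h' σ ≡ dec n}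
  ... | yes _ | yes _ = refl
  ... | no _ | no _ = refl
  ... | yes (σ , p) | no ¬q = ⊥-elim (¬q (σ , trans (sym (same σ (short h emb p n<u))) p))
  ... | no ¬p | yes (σ , q) = ⊥-elim (¬p (σ , trans (same σ (short h' emb' q n<u)) q))

  Dead : Coloring → ℕ → Str → Set
  Dead Y c ℓ = ∀ ρ → ℓ ⪯ ρ → ¬ DenseAbove (proj₁ Y) c ρ

  alive : ∀ Y c ℓ → ¬ Dead Y c ℓ → Σ Str λ ρ → ℓ ⪯ ρ × DenseAbove (proj₁ Y) c ρ
  alive Y c ℓ ¬dead with em {Σ Str λ ρ → ℓ ⪯ ρ × DenseAbove (proj₁ Y) c ρ}
  ... | yes p = p
  ... | no ¬p = ⊥-elim (¬dead λ ρ ℓ⪯ρ d → ¬p (ρ , ℓ⪯ρ , d))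

  -- Otherwise some cone would have color `c` only, and `c` would be dense there.
  dead⇒dense : ∀ Y c c' ℓ {ρ} → c ≤ 1 → c' ≤ 1 → c ≢ c' → Dead Y c ℓ → ℓ ⪯ ρ →
    DenseAbove (proj₁ Y) c' ρ
  dead⇒dense Y c c' ℓ c≤1 c'≤1 c≢c' dead ℓ⪯ρ σ ρ⪯σ with em {Σ Str λ τ → σ ⪯ τ × col′ Y τ ≡ c'}
  ... | yes p = p
  ... | no ¬p = ⊥-elim (dead σ (⪯-trans ℓ⪯ρ ρ⪯σ) λ τ σ⪯τ → τ , ⪯-refl ,
    ≢-unique (proj₂ Y _) c≤1 c'≤1 (λ q → ¬p (τ , σ⪯τ , q)) c≢c')

  images-use : ∀ X (f : ℕ → ℕ) N → Σ ℕ λ u → ∀ X' → Agree u (proj₁ X) (proj₁ X') →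
    ∀ n → n < N → proj₁ (image X') (f n) ≡ proj₁ (image X) (f n)
  images-use X f zero = 0 , λ _ _ _ ()
  images-use X f (suc N) with images-use X f N | image-use X (f N)
  ... | u , below | v , now = u ⊔ v , λ X' p n n<1+N →
    [ below X' (agree-≤ (m≤m⊔n u v) p) n , (λ { refl → now X' (agree-≤ (m≤n⊔m u v) p) }) ]′
      (m≤n⇒m<n∨m≡n (≤-pred n<1+N))

  -- If no leaf `h τ` at level `k` is dead, a tree of color `c` can be grafted above each. The
  -- result solves the image of `X'` and agrees with `range h` up to the use `k`. The bound `u`
  -- preserves the image colors of the nodes below level `k`, whose indices have codes below
  -- `2 ^ suc k`.
  answer-or-dead : ∀ X c ρ h → MonochromaticTree (proj₁ (image X)) c ρ h →
    Σ ℕ λ i → Σ Str λ σ → i ≤ 1 × Σ ℕ λ u → Σ ℕ λ k → ∀ X' → Agree u (proj₁ X) (proj₁ X') →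
      DenseAbove (proj₁ X') i σ ⊎ Σ Str λ τ → length τ ≡ k × Dead (image X') c (h τ)
  answer-or-dead X c ρ h mono@(emb , color) with answer-use X (range h) (range-solves X h c ρ mono)
  ... | i , σ , i≤1 , _ , k , stable with images-use X (λ n → enc (h (dec n))) (2 ^ suc k)
  ...   | u , image-stable = i , σ , i≤1 , k ⊔ u , k , decide
    where
    decide : ∀ X' → Agree (k ⊔ u) (proj₁ X) (proj₁ X') →
      DenseAbove (proj₁ X') i σ ⊎ Σ Str λ τ → length τ ≡ k × Dead (image X') c (h τ)
    decide X' p with em {Σ Str λ τ → length τ ≡ k × Dead (image X') c (h τ)}
    ... | yes dead = inj₂ dead
    ... | no ¬dead = inj₁ (stable X' (range g) (agree-≤ (m≤m⊔n k u) p)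
            (range-agree h g emb g-emb λ σ σ<k → sym (graft-below k h T σ σ<k))
            (range-solves X' g c [] (g-emb , λ υ → (g υ , refl) ,
              graft-elim k h T (λ τ → col′ (image X') τ ≡ c) below
                (λ τ q υ → proj₂ (proj₂ (T-mono τ q) υ)) υ)))
      where
      live : ∀ (τ : Str) → length τ ≡ k → Σ Str λ ρ → h τ ⪯ ρ × DenseAbove (proj₁ (image X')) c ρ
      live τ q = alive (image X') c (h τ) λ d → ¬dead (τ , q , d)
      T : Scions k
      T τ q = proj₁ (dense⇒tree (proj₁ (image X')) c (proj₁ (live τ q)) (proj₂ (proj₂ (live τ q))))
      T-mono : ∀ τ q → MonochromaticTree (proj₁ (image X')) c (proj₁ (live τ q)) (T τ q)
      T-mono τ q =
        proj₂ (dense⇒tree (proj₁ (image X')) c (proj₁ (live τ q)) (proj₂ (proj₂ (live τ q))))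
      g = graft k h T
      g-emb : IsEmbedding g
      g-emb = graft-embedding k h T emb (λ τ q → proj₁ (T-mono τ q))
        λ τ q υ → ⪯-trans (proj₁ (proj₂ (live τ q))) (proj₁ (proj₂ (T-mono τ q) υ))
      below : ∀ σ → length σ < k → col′ (image X') (h σ) ≡ c
      below σ σ<k = trans
        (subst (λ τ → col′ (image X') (h τ) ≡ col′ (image X) (h τ)) (dec-enc σ)
          (image-stable X' (agree-≤ (m≤n⊔m k u) p) (enc σ)
            (<-≤-trans (n<1+n _) (≤-trans (n≤1+n _) (≤-trans (enc-bound σ)
              (^-monoʳ-≤ 2 (s≤s (<⇒≤ σ<k))))))))
        (proj₂ (color σ))

  Answerable : ℕ → Coloring → Set
  Answerable M X = Σ ℕ λ i → Σ Str λ σ → i ≤ 1 × length σ ≤ M × DenseAbove (proj₁ X) i σ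

  answerable-≤ : ∀ {M M'} X → M ≤ M' → Answerable M X → Answerable M' X
  answerable-≤ X M≤M' (i , σ , i≤1 , σ≤M , d) = i , σ , i≤1 , ≤-trans σ≤M M≤M' , d

  -- The leaves are treated one by one. If some extension kills `c` above the current leaf, it is
  -- adopted, and a tree of the other color there yields an answer that lasts while `c` is dead. If
  -- none does, this leaf is never dead later.
  cover : ∀ X v {c} → c ≤ 1 → (h : Str → Str) → ∀ N →
    Σ Coloring λ X' → Σ ℕ λ v' → v ≤ v' × Agree v (proj₁ X) (proj₁ X') × Σ ℕ λ M →
      ∀ X'' → Agree v' (proj₁ X') (proj₁ X'') →
      ∀ n → n < N → Dead (image X'') c (h (dec n)) → Answerable M X''
  cover X v c≤1 h zero = X , v , ≤-refl , (λ _ _ → refl) , 0 , λ _ _ _ ()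
  cover X v {c} c≤1 h (suc N) with cover X v c≤1 h N
  ... | X₁ , v₁ , v≤v₁ , agree₁ , M₁ , covers
    with em {Σ Coloring λ Z → Agree v₁ (proj₁ X₁) (proj₁ Z) × Dead (image Z) c (h (dec N))}
  ... | no ¬p = X₁ , v₁ , v≤v₁ , agree₁ , M₁ , λ X'' p n n<1+N dead →
    [ (λ n<N → covers X'' p n n<N dead) , (λ { refl → ⊥-elim (¬p (X'' , p , dead)) }) ]′
      (m≤n⇒m<n∨m≡n (≤-pred n<1+N))
  ... | yes (Z , agree₂ , dead-Z) with flip c≤1
  ...   | b , b≢c with dense⇒tree (proj₁ (image Z)) (bit b) (h (dec N))
                    (dead⇒dense (image Z) c (bit b) (h (dec N)) c≤1 (bit≤1 b) (b≢c ∘ sym) dead-Z ⪯-refl)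
  ...     | g , mono with answer-or-dead Z (bit b) (h (dec N)) g mono
  ...       | i , σ , i≤1 , u , k , answers = Z , v₁ ⊔ u , ≤-trans v≤v₁ (m≤m⊔n v₁ u) ,
              agree-trans {β = proj₁ X₁} agree₁ (agree-≤ v≤v₁ agree₂) , M₁ ⊔ length σ , covers'
    where
    covers' : ∀ X'' → Agree (v₁ ⊔ u) (proj₁ Z) (proj₁ X'') →
      ∀ n → n < suc N → Dead (image X'') c (h (dec n)) → Answerable (M₁ ⊔ length σ) X''
    covers' X'' p n n<1+N dead with m≤n⇒m<n∨m≡n (≤-pred n<1+N)
    ... | inj₁ n<N = answerable-≤ X'' (m≤m⊔n M₁ (length σ)) (covers X''
            (agree-trans {β = proj₁ Z} agree₂ (agree-≤ (m≤m⊔n v₁ u) p)) n n<N dead)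
    ... | inj₂ refl with answers X'' (agree-≤ (m≤n⊔m v₁ u) p)
    ...   | inj₁ d = i , σ , i≤1 , m≤n⊔m M₁ (length σ) , d
    -- While `c` is dead at the leaf, the other color is dense above everything beyond it, so it
    -- cannot be dead at `g τ`.
    ...   | inj₂ (τ , _ , dead') = ⊥-elim (dead' (g τ) ⪯-refl
              (dead⇒dense (image X'') c (bit b) (h (dec n)) c≤1 (bit≤1 b) (b≢c ∘ sym) dead
                (proj₁ (proj₂ mono τ))))

  -- Beyond `v`, strings are colored by their bit at position `K`. Any `σ` of length at most `M`
  -- extends to length `K`, and the next bit can then be chosen against the answer.
  ¬answerable : ∀ X v M → ¬ (∀ X' → Agree v (proj₁ X) (proj₁ X') → Answerable M X')
  ¬answerable X v M answerable = refute (answerable X' (splice-agree v X (bitAt≤1 K)))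
    where
    K = v ⊔ M
    X' = splice v X (bitAt K) (bitAt≤1 K)
    refute : ¬ Answerable M X'
    refute (i , σ , i≤1 , σ≤M , dense) with flip i≤1 | extend-to σ (≤-trans σ≤M (m≤n⊔m v M))
    ... | b , b≢i | ρ , σ⪯ρ , ρ≡K with dense (ρ ++ b ∷ []) (⪯-trans σ⪯ρ (⪯-++ ρ))
    ...   | τ , ρb⪯τ , τ-i = b≢i (trans (sym (bitAt-snoc ρ b ρb⪯τ)) (trans (cong (λ k → bitAt k τ) ρ≡K)
              (trans (sym (splice-beyond v X (bitAt≤1 K) τ
                (≤-trans (m≤m⊔n v M) (≤-trans (≤-reflexive (sym ρ≡K))
                  (⪯-length (⪯-trans (⪯-++ ρ) ρb⪯τ)))))) τ-i)))

  tree-exists : ∀ Y → Σ ℕ λ c → c ≤ 1 × Σ Str λ ρ → Σ (Str → Str) (MonochromaticTree (proj₁ Y) c ρ)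
  tree-exists Y with em {Dead Y 0 []}
  ... | yes dead = 1 , ≤-refl , [] , dense⇒tree (proj₁ Y) 1 []
                 (dead⇒dense Y 0 1 [] z≤n ≤-refl (λ ()) dead ⪯-refl)
  ... | no ¬dead with alive Y 0 [] ¬dead
  ...   | ρ , _ , d = 0 , z≤n , ρ , dense⇒tree (proj₁ Y) 0 ρ d

  zeros : Coloring
  zeros = (λ _ → 0) , λ _ → z≤n

  absurd : ⊥
  absurd with tree-exists (image zeros)
  ... | c , c≤1 , ρ , h , mono with answer-or-dead zeros c ρ h mono
  ...   | i , σ , i≤1 , u , k , answers with cover zeros u c≤1 h (2 ^ suc k)
  ...     | X , v , u≤v , agree , M , covers = ¬answerable X v (M ⊔ length σ) answerable
    where
    answerable : ∀ X' → Agree v (proj₁ X) (proj₁ X') → Answerable (M ⊔ length σ) X'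
    answerable X' p with answers X' (agree-trans {β = proj₁ X} agree (agree-≤ u≤v p))
    ... | inj₁ d = i , σ , i≤1 , m≤n⊔m M (length σ) , d
    ... | inj₂ (τ , refl , dead) = answerable-≤ X' (m≤m⊔n M (length σ))
      (covers X' p (enc τ) (<-≤-trans (n<1+n _) (≤-trans (n≤1+n _) (enc-bound τ)))
        (subst (λ ρ → Dead (image X') c (h ρ)) (sym (dec-enc τ)) dead))

V0≰TT12 : ExcludedMiddle 0ℓ → ¬ (V0 ≤W TT12)
V0≰TT12 em red = V0≰TT12.absurd em (≤W⇒continuous (λ _ p → p) (λ _ p → p) (λ _ _ s → s) red)

theorem3p4 : ExcludedMiddle 0ℓ →
    (TT12 <W V0) × (V0 ≡W V1) × (V1 <W V2) × (V2 ≡W V3) × (V3 ≡W V4)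
theorem3p4 em =
  (TT12≤V0.reduction , V0≰TT12 em) , V0≡V1 em , (V1≤V2 em , V2≰V1 em) , V2≡V3 em , V3≡V4 em
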